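{- For all $\eta,\gamma\in\mathbb{C}$, the function $\Omega_{\eta,\gamma}:\mathbb{C}\to\mathbb{C}$ defined by \[\Omega_{\eta,\gamma}(n)=\eta\cdot(-1)^{n-1}\cdot\Theta(n)+\gamma\cdot(-1)^{n}\cdot\Theta(n-1)\cdot\phi,\qquad n\in\mathbb{C},\] is a complex complete nFe-sequence, i.e. $\Omega_{\eta,\gamma}(n)=\Omega_{\eta,\gamma}(n-2)-\Omega_{\eta,\gamma}(n-1)$ for all $n\in\mathbb{C}$.
   Context: $\phi=\frac{1+\sqrt5}{2}$. For complex $n$, $(-1)^n:=\exp(i\pi n)$, $\phi^n:=\exp(n\log\phi)$ with the real logarithm of $\phi$, and $(-\phi)^n:=(-1)^n\cdot\phi^n=\exp(i\pi n)\,\phi^n$. The function $\Theta:\mathbb{C}\to\mathbb{C}$ is $\Theta(n)=\frac{\phi^n-(-\phi)^{ -n}}{\sqrt5}$ (it extends the Fibonacci numbers). A function $\tilde\omega:\mathbb{C}\to\mathbb{C}$ is called a complex complete nFe-sequence (negaFibonacci-esque sequence) if $\tilde\omega(n)=\tilde\omega(n-2)-\tilde\omega(n-1)$ for all $n\in\mathbb{C}$. -}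

module Defs where

open import Data.Nat as ℕ using (ℕ; zero; suc)
import Data.Nat.Properties as ℕP
open import Data.Integer.Base as ℤ using (+_; +[1+_]; -[1+_])
import Data.Integer.Properties as ℤP
open import Data.Nat.Coprimality using (1-coprimeTo) renaming (sym to coprime-sym)
open import Data.Rational
open import Data.Rational.Properties
import Data.Rational.Unnormalised.Base as ℚᵘ
open import Data.Rational.Solver
open import Data.Product using (_×_; _,_; proj₁; proj₂; ∃-syntax)
open import Data.Sum using (_⊎_; inj₁; inj₂)
open import Data.Empty using (⊥-elim)
open import Function.Definitions using (Congruent)
open import Relation.Nullary using (yes; no)
open import Relation.Binary.PropositionalEquality
open +-*-Solver

-- ℝ is the setoid of Cauchy sequences of rationals, ℂ = ℝ × ℝ, and exp on ℂ is
-- the power series.  The constants √5, log φ and π are constructed as the zeros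
-- of q² - 5, e^q - φ and cos (q / 2).

0≤1 : 0ℚ ≤ 1ℚ
0≤1 = nonNegative⁻¹ 1ℚ

le : ∀ {p q} r → 0ℚ ≤ r → q ≡ p + r → p ≤ q
le {p} r 0≤r refl = subst (_≤ p + r) (+-identityʳ p) (+-monoʳ-≤ p 0≤r)

gap : ∀ {p q} → p ≤ q → 0ℚ ≤ q - p
gap {p} {q} p≤q = subst (_≤ q - p) (+-inverseʳ p) (+-monoˡ-≤ (- p) p≤q)

add0 : ∀ {p q} → 0ℚ ≤ p → 0ℚ ≤ q → 0ℚ ≤ p + q
add0 = +-mono-≤

mul0 : ∀ {p q} → 0ℚ ≤ p → 0ℚ ≤ q → 0ℚ ≤ p * q
mul0 {p} {q} 0≤p 0≤q = nonNegative⁻¹ (p * q)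
  {{nonNeg*nonNeg⇒nonNeg p {{nonNegative 0≤p}} q {{nonNegative 0≤q}}}}

mul-mono : ∀ {a b c d} → 0ℚ ≤ a → a ≤ b → 0ℚ ≤ c → c ≤ d → a * c ≤ b * d
mul-mono {a} {b} {c} {d} 0≤a a≤b 0≤c c≤d =
  le (a * (d - c) + (b - a) * d)
     (add0 (mul0 0≤a (gap c≤d)) (mul0 (gap a≤b) (≤-trans 0≤c c≤d)))
     (solve 4 (λ a b c d → b :* d := a :* c :+ (a :* (d :- c) :+ (b :- a) :* d)) refl a b c d)

∣-∣-sym : ∀ p q → ∣ p - q ∣ ≡ ∣ q - p ∣
∣-∣-sym p q = trans (cong ∣_∣ (solve 2 (λ p q → p :- q := :- (q :- p)) refl p q)) (∣-p∣≡∣p∣ (q - p))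

p≤∣p∣ : ∀ p → p ≤ ∣ p ∣
p≤∣p∣ p with ≤-total 0ℚ p
... | inj₁ 0≤p = ≤-reflexive (sym (0≤p⇒∣p∣≡p 0≤p))
... | inj₂ p≤0 = ≤-trans p≤0 (0≤∣p∣ p)

∣∣≤ : ∀ {p e} → p ≤ e → - p ≤ e → ∣ p ∣ ≤ e
∣∣≤ {p} p≤e -p≤e with ∣p∣≡p∨∣p∣≡-p p
... | inj₁ eq rewrite eq = p≤e
... | inj₂ eq rewrite eq = -p≤e

tri : ∀ p q r → ∣ p - r ∣ ≤ ∣ p - q ∣ + ∣ q - r ∣
tri p q r = subst (λ t → ∣ t ∣ ≤ ∣ p - q ∣ + ∣ q - r ∣)
  (solve 3 (λ p q r → (p :- q) :+ (q :- r) := p :- r) refl p q r)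
  (∣p+q∣≤∣p∣+∣q∣ (p - q) (q - r))

half-pos : ∀ {ε} → 0ℚ < ε → 0ℚ < ε * ½
half-pos {ε} 0<ε = positive⁻¹ (ε * ½) {{pos*pos⇒pos ε {{positive 0<ε}} ½}}

halves : ∀ ε → ε * ½ + ε * ½ ≡ ε
halves ε = solve 1 (λ ε → ε :* con ½ :+ ε :* con ½ := ε) refl ε

shrink : ∀ B ε → 0ℚ ≤ B → 0ℚ < ε → ∃[ δ ] 0ℚ < δ × B * δ ≤ ε
shrink B ε 0≤B 0<ε = ε * r , 0<εr , le (ε * r) (<⇒≤ 0<εr) eq
  where
  c = 1ℚ + B
  0<c : 0ℚ < c
  0<c = <-≤-trans (positive⁻¹ 1ℚ) (le B 0≤B refl)
  instance
    c⁺ : Positive c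
    c⁺ = positive 0<c
    c≠0 : NonZero c
    c≠0 = pos⇒nonZero c
  r = 1/ c
  0<εr : 0ℚ < ε * r
  0<εr = positive⁻¹ (ε * r) {{pos*pos⇒pos ε {{positive 0<ε}} r {{1/pos⇒pos c}}}}
  eq : ε ≡ B * (ε * r) + ε * r
  eq = trans (sym (*-identityʳ ε)) (trans (cong (ε *_) (sym (*-inverseˡ c)))
    (solve 3 (λ e r b → e :* (r :* (con 1ℚ :+ b)) := b :* (e :* r) :+ e :* r) refl ε r B))

ι : ℕ → ℚ
ι n = + n / 1

recip : ℕ → ℚ
recip k = + 1 / suc k

ι-mk : ∀ n → ι n ≡ mkℚ (+ n) 0 (coprime-sym (1-coprimeTo n))
ι-mk n = normalize-coprime _

recip-mk : ∀ k → recip k ≡ mkℚ (+ 1) k (1-coprimeTo (suc k))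
recip-mk k = normalize-coprime _

ι-suc : ∀ n → ι (suc n) ≡ 1ℚ + ι n
ι-suc n = trans (cong (λ i → i / 1) (trans (cong (λ t → + suc t) (sym (ℕP.*-identityʳ n)))
  (sym (ℤP.pos-+ 1 (n ℕ.* 1))))) (trans (cong (λ i → (+ 1 ℤ.+ i) / 1) (ℤP.pos-* n 1)) (cong (λ t → 1ℚ + t) (sym (ι-mk n))))

recip-ι : ∀ k → recip k * ι (suc k) ≡ 1ℚ
recip-ι k rewrite recip-mk k | ι-mk (suc k) =
  fromℚᵘ-cong {ℚᵘ.mkℚᵘ (+ suc (k ℕ.+ 0)) (k ℕ.* 1)} {ℚᵘ.mkℚᵘ (+ 1) 0}
    (ℚᵘ.*≡* (cong +_ (trans (ℕP.*-identityʳ _) (trans (cong suc (trans (ℕP.+-identityʳ k) (sym (ℕP.*-identityʳ k)))) (sym (ℕP.*-identityˡ _))))))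

ι-mono : ∀ {m n} → m ℕ.≤ n → ι m ≤ ι n
ι-mono {m} {n} m≤n rewrite ι-mk m | ι-mk n = *≤* (ℤP.*-monoʳ-≤-nonNeg (+ 1) (ℤ.+≤+ m≤n))

0≤ι : ∀ n → 0ℚ ≤ ι n
0≤ι n = ι-mono {0} {n} ℕ.z≤n

recip-anti : ∀ {m n} → m ℕ.≤ n → recip n ≤ recip m
recip-anti {m} {n} m≤n rewrite recip-mk m | recip-mk n =
  *≤* (ℤP.*-monoˡ-≤-nonNeg (+ 1) (ℤ.+≤+ (ℕ.s≤s m≤n)))

0<recip : ∀ n → 0ℚ < recip n
0<recip n = positive⁻¹ (recip n) {{normalize-pos 1 (suc n)}}

0≤recip : ∀ n → 0ℚ ≤ recip n
0≤recip n = <⇒≤ (0<recip n)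

archimedean : ∀ q → ∃[ n ] q ≤ ι n
archimedean (mkℚ (+ a) d c) = a , subst (mkℚ (+ a) d c ≤_) (sym (ι-mk a))
  (*≤* (ℤP.*-monoˡ-≤-nonNeg (+ a) (ℤ.+≤+ (ℕ.s≤s ℕ.z≤n))))
archimedean (mkℚ -[1+ a ] d c) = 0 , *≤* ℤ.-≤+

small-recip : ∀ ε → 0ℚ < ε → ∃[ n ] recip n ≤ ε
small-recip (mkℚ +[1+ a ] d c) _ = d , subst (_≤ mkℚ +[1+ a ] d c) (sym (recip-mk d))
  (*≤* (ℤP.*-monoʳ-≤-nonNeg (+ suc d) (ℤ.+≤+ (ℕ.s≤s (ℕ.z≤n {a})))))
small-recip (mkℚ (+ 0) d c) (*<* (ℤ.+<+ ()))
small-recip (mkℚ -[1+ a ] d c) (*<* ())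

Cauchy : (ℕ → ℚ) → Set
Cauchy x = ∀ ε → 0ℚ < ε → ∃[ N ] ∀ m n → N ℕ.≤ m → N ℕ.≤ n → ∣ x m - x n ∣ ≤ ε

bounded : ∀ {x} → Cauchy x → ∃[ B ] 0ℚ ≤ B × (∀ n → ∣ x n ∣ ≤ B)
bounded {x} c with c 1ℚ (positive⁻¹ 1ℚ)
... | N , near = B , 0≤B , bound
  where
  sumAbs : ℕ → ℚ
  sumAbs zero    = 0ℚ
  sumAbs (suc n) = sumAbs n + ∣ x n ∣
  0≤sum : ∀ n → 0ℚ ≤ sumAbs n
  0≤sum zero    = ≤-refl
  0≤sum (suc n) = add0 (0≤sum n) (0≤∣p∣ (x n))
  below : ∀ n k → k ℕ.< n → ∣ x k ∣ ≤ sumAbs n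
  below (suc n) k (ℕ.s≤s k≤n) with ℕP.m≤n⇒m<n∨m≡n k≤n
  ... | inj₁ k<n  = ≤-trans (below n k k<n) (le ∣ x n ∣ (0≤∣p∣ (x n)) refl)
  ... | inj₂ refl = le (sumAbs n) (0≤sum n) (+-comm (sumAbs n) ∣ x n ∣)
  rest = 1ℚ + ∣ x N ∣
  0≤rest : 0ℚ ≤ rest
  0≤rest = add0 0≤1 (0≤∣p∣ (x N))
  B = sumAbs N + rest
  0≤B : 0ℚ ≤ B
  0≤B = add0 (0≤sum N) 0≤rest
  bound : ∀ n → ∣ x n ∣ ≤ B
  bound n with ℕP.<-≤-connex n N
  ... | inj₁ n<N = ≤-trans (below N n n<N) (le rest 0≤rest refl)
  ... | inj₂ N≤n = ≤-trans
    (subst (λ t → ∣ t ∣ ≤ ∣ x n - x N ∣ + ∣ x N ∣)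
      (solve 2 (λ a b → a :- b :+ b := a) refl (x n) (x N)) (∣p+q∣≤∣p∣+∣q∣ (x n - x N) (x N)))
    (≤-trans (+-monoˡ-≤ ∣ x N ∣ (near n N N≤n ℕP.≤-refl))
      (le (sumAbs N) (0≤sum N) (+-comm (sumAbs N) rest)))

abstract
  const-cauchy : ∀ q → Cauchy (λ _ → q)
  const-cauchy q ε 0<ε = 0 , λ _ _ _ _ → subst (λ t → ∣ t ∣ ≤ ε) (sym (+-inverseʳ q)) (<⇒≤ 0<ε)

abstract
  +-cauchy : ∀ {x y} → Cauchy x → Cauchy y → Cauchy (λ n → x n + y n)
  +-cauchy {x} {y} c d ε 0<ε with c (ε * ½) (half-pos 0<ε) | d (ε * ½) (half-pos 0<ε)
  ... | N , near | M , near′ = N ℕ.⊔ M , λ m n p q →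
    subst₂ _≤_
      (cong ∣_∣ (solve 4 (λ a b c d → (a :- c) :+ (b :- d) := a :+ b :- (c :+ d)) refl (x m) (y m) (x n) (y n)))
      (halves ε)
      (≤-trans (∣p+q∣≤∣p∣+∣q∣ (x m - x n) (y m - y n))
        (+-mono-≤ (near m n (ℕP.m⊔n≤o⇒m≤o N M p) (ℕP.m⊔n≤o⇒m≤o N M q))
                  (near′ m n (ℕP.m⊔n≤o⇒n≤o N M p) (ℕP.m⊔n≤o⇒n≤o N M q))))

abstract
  neg-cauchy : ∀ {x} → Cauchy x → Cauchy (λ n → - x n)
  neg-cauchy {x} c ε 0<ε with c ε 0<ε
  ... | N , near = N , λ m n p q → subst (_≤ ε)
    (trans (∣-∣-sym (x m) (x n)) (cong ∣_∣ (solve 2 (λ a b → b :- a := :- a :- (:- b)) refl (x m) (x n)))) (near m n p q)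

*-near : ∀ {a b c d A B δ} → ∣ a ∣ ≤ A → ∣ d ∣ ≤ B → ∣ a - c ∣ ≤ δ → ∣ b - d ∣ ≤ δ →
         ∣ a * b - c * d ∣ ≤ (A + B) * δ
*-near {a} {b} {c} {d} {A} {B} {δ} a≤ d≤ ac bd = subst₂ _≤_ (cong ∣_∣ (sym split)) (sym (*-distribʳ-+ δ A B))
  (≤-trans (∣p+q∣≤∣p∣+∣q∣ (a * (b - d)) (d * (a - c)))
    (+-mono-≤ (subst (_≤ A * δ) (sym (∣p*q∣≡∣p∣*∣q∣ a (b - d))) (mul-mono (0≤∣p∣ a) a≤ (0≤∣p∣ (b - d)) bd))
              (subst (_≤ B * δ) (sym (∣p*q∣≡∣p∣*∣q∣ d (a - c))) (mul-mono (0≤∣p∣ d) d≤ (0≤∣p∣ (a - c)) ac))))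
  where
  split : a * b - c * d ≡ a * (b - d) + d * (a - c)
  split = solve 4 (λ a b c d → a :* b :- c :* d := a :* (b :- d) :+ d :* (a :- c)) refl a b c d

abstract
  *-cauchy : ∀ {x y} → Cauchy x → Cauchy y → Cauchy (λ n → x n * y n)
  *-cauchy {x} {y} c d ε 0<ε =
    let A , 0≤A , ∣x∣≤A = bounded c
        B , 0≤B , ∣y∣≤B = bounded d
        δ , 0<δ , small = shrink (A + B) ε (add0 0≤A 0≤B) 0<ε
        N , near  = c δ 0<δ
        M , near′ = d δ 0<δ
    in N ℕ.⊔ M , λ m n p q → ≤-trans {∣ x m * y m - x n * y n ∣} {(A + B) * δ} {ε}
        (*-near {x m} {y m} {x n} {y n} {A} {B} {δ} (∣x∣≤A m) (∣y∣≤B n)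
          (near m n (ℕP.m⊔n≤o⇒m≤o N M p) (ℕP.m⊔n≤o⇒m≤o N M q))
          (near′ m n (ℕP.m⊔n≤o⇒n≤o N M p) (ℕP.m⊔n≤o⇒n≤o N M q)))
        small

approx-near : ∀ {ε} a b c d → ∣ a - b ∣ ≤ ε * ½ * ½ → ∣ b - c ∣ ≤ ε * ½ → ∣ d - c ∣ ≤ ε * ½ * ½ → ∣ a - d ∣ ≤ ε
approx-near {ε} a b c d ab bc dc = subst (∣ a - d ∣ ≤_)
  (solve 1 (λ e → e :* con ½ :* con ½ :+ (e :* con ½ :+ e :* con ½ :* con ½) := e) refl ε)
  (≤-trans (tri a b d) (+-mono-≤ ab (≤-trans (tri b c d) (+-mono-≤ bc (subst (_≤ ε * ½ * ½) (∣-∣-sym d c) dc)))))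

abstract
  approx-cauchy : ∀ {u} → (∀ ε → 0ℚ < ε → ∃[ v ] Cauchy v × ∃[ N ] ∀ n → N ℕ.≤ n → ∣ u n - v n ∣ ≤ ε) → Cauchy u
  approx-cauchy {u} approx ε 0<ε =
    let v , c , N , close = approx (ε * ½ * ½) (half-pos (half-pos 0<ε))
        M , near = c (ε * ½) (half-pos 0<ε)
    in N ℕ.⊔ M , λ m n p q → approx-near (u m) (v m) (v n) (u n)
         (close m (ℕP.m⊔n≤o⇒m≤o N M p))
         (near m n (ℕP.m⊔n≤o⇒n≤o N M p) (ℕP.m⊔n≤o⇒n≤o N M q))
         (close n (ℕP.m⊔n≤o⇒m≤o N M q))

inv : ℚ → ℚ
inv q with q ≟ 0ℚ
... | yes _   = 0ℚ
... | no q≢0 = (1/ q) {{≢-nonZero q≢0}}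

inv-inverse : ∀ q → q ≢ 0ℚ → q * inv q ≡ 1ℚ
inv-inverse q q≢0 with q ≟ 0ℚ
... | yes q≡0 = ⊥-elim (q≢0 q≡0)
... | no  q≢0 = *-inverseʳ q {{≢-nonZero q≢0}}

Apart : (ℕ → ℚ) → Set
Apart x = ∃[ δ ] 0ℚ < δ × ∃[ N ] ∀ n → N ℕ.≤ n → δ ≤ ∣ x n ∣

inv-pos : ∀ {δ} → 0ℚ < δ → 0ℚ ≤ inv δ
inv-pos {δ} 0<δ with δ ≟ 0ℚ
... | yes _   = ≤-refl
... | no δ≢0 = <⇒≤ (positive⁻¹ ((1/ δ) {{≢-nonZero δ≢0}}) {{1/pos⇒pos δ {{positive 0<δ}}}})

inv-≤ : ∀ {δ q} → 0ℚ < δ → δ ≤ ∣ q ∣ → q ≢ 0ℚ → ∣ inv q ∣ ≤ inv δ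
inv-≤ {δ} {q} 0<δ away q≢0 = subst₂ _≤_
  (trans (solve 3 (λ d i j → d :* (j :* i) := (d :* j) :* i) refl δ ∣ inv q ∣ (inv δ))
    (trans (cong (_* ∣ inv q ∣) (inv-inverse δ δ≢0)) (*-identityˡ ∣ inv q ∣)))
  (trans (solve 3 (λ a i j → a :* (j :* i) := (a :* i) :* j) refl ∣ q ∣ ∣ inv q ∣ (inv δ))
    (trans (cong (_* inv δ) (trans (sym (∣p*q∣≡∣p∣*∣q∣ q (inv q))) (cong ∣_∣ (inv-inverse q q≢0)))) (*-identityˡ (inv δ))))
  (mul-mono (<⇒≤ 0<δ) away (mul0 (inv-pos 0<δ) (0≤∣p∣ (inv q))) (≤-refl {inv δ * ∣ inv q ∣}))
  where
  δ≢0 : δ ≢ 0ℚ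
  δ≢0 δ≡0 = <-irrefl (sym δ≡0) 0<δ

inv-near : ∀ {a b I η} → 0ℚ ≤ I → a ≢ 0ℚ → b ≢ 0ℚ → ∣ inv a ∣ ≤ I → ∣ inv b ∣ ≤ I → ∣ b - a ∣ ≤ η →
           ∣ inv a - inv b ∣ ≤ I * I * η
inv-near {a} {b} {I} {η} 0≤I a≢0 b≢0 ia ib ab = subst (_≤ I * I * η)
  (sym (trans (cong ∣_∣ differ) (trans (∣p*q∣≡∣p∣*∣q∣ (inv a * inv b) (b - a))
    (cong (_* ∣ b - a ∣) (∣p*q∣≡∣p∣*∣q∣ (inv a) (inv b))))))
  (mul-mono (mul0 (0≤∣p∣ (inv a)) (0≤∣p∣ (inv b)))
    (mul-mono (0≤∣p∣ (inv a)) ia (0≤∣p∣ (inv b)) ib) (0≤∣p∣ (b - a)) ab)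
  where
  differ : inv a - inv b ≡ inv a * inv b * (b - a)
  differ = trans
    (cong₂ _-_ (trans (sym (*-identityʳ (inv a))) (cong (inv a *_) (sym (inv-inverse b b≢0))))
               (trans (sym (*-identityʳ (inv b))) (cong (inv b *_) (sym (inv-inverse a a≢0)))))
    (solve 4 (λ a b i j → i :* (b :* j) :- j :* (a :* i) := i :* j :* (b :- a)) refl a b (inv a) (inv b))

abstract
  inv-cauchy : ∀ {x} → Cauchy x → Apart x → Cauchy (λ n → inv (x n))
  inv-cauchy {x} c (δ , 0<δ , K , away) ε 0<ε =
    let η , 0<η , small = shrink (inv δ * inv δ) ε (mul0 (inv-pos 0<δ) (inv-pos 0<δ)) 0<ε
        N , near = c η 0<η
    in N ℕ.⊔ K , λ m n p q →
    let m≥N = ℕP.m⊔n≤o⇒m≤o N K p ; n≥N = ℕP.m⊔n≤o⇒m≤o N K q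
        m≥K = ℕP.m⊔n≤o⇒n≤o N K p ; n≥K = ℕP.m⊔n≤o⇒n≤o N K q
    in ≤-trans {∣ inv (x m) - inv (x n) ∣} {inv δ * inv δ * η} {ε}
         (inv-near {x m} {x n} {inv δ} {η} (inv-pos 0<δ) (apart m m≥K) (apart n n≥K)
           (inv-≤ 0<δ (away m m≥K) (apart m m≥K)) (inv-≤ 0<δ (away n n≥K) (apart n n≥K)) (near n m n≥N m≥N))
         small
    where
    apart : ∀ n → K ℕ.≤ n → x n ≢ 0ℚ
    apart n K≤n xn≡0 = <-irrefl refl (<-≤-trans 0<δ (subst (λ t → δ ≤ ∣ t ∣) xn≡0 (away n K≤n)))

-- the greatest k ≤ m with g k ≤ 0, or 0 if there is none among 1 , … , m
lastNonPos : (ℕ → ℚ) → ℕ → ℕ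
lastNonPos g zero = 0
lastNonPos g (suc m) with g (suc m) ≤? 0ℚ
... | yes _ = suc m
... | no  _ = lastNonPos g m

last-≤ : ∀ g m → lastNonPos g m ℕ.≤ m
last-≤ g zero = ℕ.z≤n
last-≤ g (suc m) with g (suc m) ≤? 0ℚ
... | yes _ = ℕP.≤-refl
... | no  _ = ℕP.m≤n⇒m≤1+n (last-≤ g m)

last-nonPos : ∀ g m → lastNonPos g m ≡ 0 ⊎ g (lastNonPos g m) ≤ 0ℚ
last-nonPos g zero = inj₁ refl
last-nonPos g (suc m) with g (suc m) ≤? 0ℚ
... | yes g≤0 = inj₂ g≤0
... | no  _   = last-nonPos g m

last-max : ∀ g m k → lastNonPos g m ℕ.< k → k ℕ.≤ m → 0ℚ < g k
last-max g zero k lt k≤0 = ⊥-elim (ℕP.<⇒≱ lt k≤0)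
last-max g (suc m) k lt k≤m with g (suc m) ≤? 0ℚ
... | yes _ = ⊥-elim (ℕP.<⇒≱ lt k≤m)
... | no g≰0 with ℕP.m≤n⇒m<n∨m≡n k≤m
...   | inj₁ (ℕ.s≤s k≤m′) = last-max g m k lt k≤m′
...   | inj₂ refl = ≰⇒> g≰0

grid : ℚ → ℕ → ℕ → ℚ
grid a n k = a + ι k * recip n

-- rootSeq f a n is the greatest q among a + k / (n + 1), k ≤ n + 1, with f n q ≤ 0
-- (or a).  If the f n are increasing and converge uniformly on [a , a + 1] to a
-- function changing sign there, this sequence converges to the zero of the limit.
rootSeq : (ℕ → ℚ → ℚ) → ℚ → ℕ → ℚ
rootSeq f a n = grid a n (lastNonPos (λ k → f n (grid a n k)) (suc n))

record Increasing (f : ℕ → ℚ → ℚ) (a : ℚ) : Set where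
  field
    C     : ℚ
    0≤C   : 0ℚ ≤ C
    slope : ∀ n x y → a ≤ x → x ≤ y → y ≤ a + 1ℚ → y - x ≤ C * (f n y - f n x)
    unif  : ∀ ε → 0ℚ < ε → ∃[ N ] ∀ m n → N ℕ.≤ m → N ℕ.≤ n →
            ∀ q → a ≤ q → q ≤ a + 1ℚ → f n q ≤ f m q + ε

a≤grid : ∀ a n k → a ≤ grid a n k
a≤grid a n k = le (ι k * recip n) (mul0 (0≤ι k) (0≤recip n)) refl

grid-top : ∀ a n → grid a n (suc n) ≡ a + 1ℚ
grid-top a n = cong (λ t → a + t) (trans (*-comm (ι (suc n)) (recip n)) (recip-ι n))

grid≤ : ∀ a n k → k ℕ.≤ suc n → grid a n k ≤ a + 1ℚ
grid≤ a n k k≤ = subst (grid a n k ≤_) (grid-top a n)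
  (+-monoʳ-≤ a (mul-mono (0≤ι k) (ι-mono k≤) (0≤recip n) ≤-refl))

grid-suc : ∀ a n k → grid a n (suc k) ≡ grid a n k + recip n
grid-suc a n k = trans (cong (λ t → a + t * recip n) (ι-suc k))
  (solve 3 (λ a i r → a :+ (con 1ℚ :+ i) :* r := a :+ i :* r :+ r) refl a (ι k) (recip n))

grid-0 : ∀ a n → grid a n 0 ≡ a
grid-0 a n = trans (cong (λ t → a + t) (*-zeroˡ (recip n))) (+-identityʳ a)

a≤root : ∀ f a n → a ≤ rootSeq f a n
a≤root f a n = a≤grid a n (lastNonPos (λ k → f n (grid a n k)) (suc n))

root≤ : ∀ f a n → rootSeq f a n ≤ a + 1ℚ
root≤ f a n = grid≤ a n _ (last-≤ (λ k → f n (grid a n k)) (suc n))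

far : ∀ {C x y δ} → 0ℚ ≤ C → x ≤ δ → 0ℚ ≤ y → C * (x - y) ≤ C * δ
far {C} {x} {y} {δ} 0≤C x≤δ 0≤y = *-monoˡ-≤-nonNeg C {{nonNegative 0≤C}} (le (δ - x + y) (add0 (gap x≤δ) 0≤y)
  (solve 3 (λ d x y → d := x :- y :+ (d :- x :+ y)) refl δ x y))

combine : ∀ {r s h e d} → r ≤ h → e ≤ h → s - (d + r) ≤ e → s ≤ d + (h + h)
combine {r} {s} {h} {e} {d} r≤h e≤h s≤ = le (h - r + (e - (s - (d + r)) + (h - e))) (add0 (gap r≤h) (add0 (gap s≤) (gap e≤h)))
  (solve 5 (λ r s h e d → d :+ (h :+ h) := s :+ (h :- r :+ (e :- (s :- (d :+ r)) :+ (h :- e)))) refl r s h e d)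

module _ (f : ℕ → ℚ → ℚ) (a : ℚ) (inc : Increasing f a) where
  open Increasing inc

  root-near : ∀ {h δ} m n → 0ℚ ≤ h → recip n ≤ h → C * δ ≤ h →
              (∀ q → a ≤ q → q ≤ a + 1ℚ → f n q ≤ f m q + δ) → rootSeq f a m ≤ rootSeq f a n + (h + h)
  root-near {h} {δ} m n 0≤h rn≤h Cδ≤h close =
    cases (ℕP.m≤n⇒m<n∨m≡n (last-≤ gn (suc n))) (last-nonPos gm (suc m)) (≤-total rm top)
    where
    gm gn : ℕ → ℚ
    gm k = f m (grid a m k)
    gn k = f n (grid a n k)
    kn km : ℕ
    kn = lastNonPos gn (suc n)
    km = lastNonPos gm (suc m)
    rm rn top : ℚ
    rm = rootSeq f a m
    rn = rootSeq f a n
    top = grid a n (suc kn)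
    up : ∀ {s} → s ≤ rn → s ≤ rn + (h + h)
    up s≤ = ≤-trans s≤ (le (h + h) (add0 0≤h 0≤h) refl)
    cases : kn ℕ.< suc n ⊎ kn ≡ suc n → km ≡ 0 ⊎ gm km ≤ 0ℚ → rm ≤ top ⊎ top ≤ rm → rm ≤ rn + (h + h)
    cases (inj₂ kn≡) _ _ = up (subst (rm ≤_) (sym (trans (cong (grid a n) kn≡) (grid-top a n))) (root≤ f a m))
    cases _ (inj₁ km≡0) _ = up (subst (_≤ rn) (sym (trans (cong (grid a m) km≡0) (grid-0 a m))) (a≤root f a n))
    cases _ _ (inj₁ rm≤top) = ≤-trans (subst (rm ≤_) (grid-suc a n kn) rm≤top)
      (+-monoʳ-≤ rn (≤-trans rn≤h (le h 0≤h refl)))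
    cases (inj₁ kn<) (inj₂ gm≤0) (inj₂ top≤rm) = combine {d = rn} rn≤h Cδ≤h (subst (λ t → rm - t ≤ C * δ) (grid-suc a n kn)
      (≤-trans (slope n top rm (a≤grid a n (suc kn)) top≤rm (root≤ f a m)) (far 0≤C frm≤ 0≤ftop)))
      where
      frm≤ : f n rm ≤ δ
      frm≤ = ≤-trans (close rm (a≤root f a m) (root≤ f a m))
               (subst (f m rm + δ ≤_) (+-identityˡ δ) (+-monoˡ-≤ δ gm≤0))
      0≤ftop : 0ℚ ≤ f n top
      0≤ftop = <⇒≤ (last-max gn (suc n) (suc kn) ℕP.≤-refl kn<)

  abstract
    root-cauchy : Cauchy (rootSeq f a)
    root-cauchy ε 0<ε =
      let δ , 0<δ , Cδ≤ = shrink C (ε * ½) 0≤C (half-pos 0<ε)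
          K , rK≤ = small-recip (ε * ½) (half-pos 0<ε)
          N , close = unif δ 0<δ
          0≤h = <⇒≤ (half-pos 0<ε)
          key : ∀ m n → N ℕ.⊔ K ℕ.≤ m → N ℕ.⊔ K ℕ.≤ n → r m ≤ r n + ε
          key m n p q = subst (λ t → r m ≤ r n + t) (halves ε)
            (root-near m n 0≤h (≤-trans (recip-anti (ℕP.m⊔n≤o⇒n≤o N K q)) rK≤) Cδ≤
              (close m n (ℕP.m⊔n≤o⇒m≤o N K p) (ℕP.m⊔n≤o⇒m≤o N K q)))
      in N ℕ.⊔ K , λ m n p q → ∣∣≤ (shift (r m) (r n) (key m n p q))
        (subst (_≤ ε) (solve 2 (λ a b → b :- a := :- (a :- b)) refl (r m) (r n)) (shift (r n) (r m) (key n m q p)))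
      where
      r : ℕ → ℚ
      r = rootSeq f a
      shift : ∀ x y → x ≤ y + ε → x - y ≤ ε
      shift x y x≤ = le (y + ε - x) (gap x≤) (solve 3 (λ x y e → e := x :- y :+ (y :+ e :- x)) refl x y ε)

-- z · w is the product in ℚ(i); expTerm k z = z^k / k!, expSum n z = Σ_{k<n} z^k / k!
_·_ : ℚ × ℚ → ℚ × ℚ → ℚ × ℚ
(a , b) · (c , d) = a * c - b * d , a * d + b * c

expTerm : ℕ → ℚ × ℚ → ℚ × ℚ
expTerm zero    z = 1ℚ , 0ℚ
expTerm (suc k) z = proj₁ (expTerm k z · z) * recip k , proj₂ (expTerm k z · z) * recip k

expSum : ℕ → ℚ × ℚ → ℚ × ℚ
expSum zero    z = 0ℚ , 0ℚ
expSum (suc n) z = proj₁ (expSum n z) + proj₁ (expTerm n z) , proj₂ (expSum n z) + proj₂ (expTerm n z)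

∥_∥ : ℚ × ℚ → ℚ
∥ a , b ∥ = ∣ a ∣ + ∣ b ∣

0≤∥∥ : ∀ z → 0ℚ ≤ ∥ z ∥
0≤∥∥ (a , b) = add0 (0≤∣p∣ a) (0≤∣p∣ b)

re≤∥∥ : ∀ z → ∣ proj₁ z ∣ ≤ ∥ z ∥
re≤∥∥ (a , b) = le ∣ b ∣ (0≤∣p∣ b) refl

im≤∥∥ : ∀ z → ∣ proj₂ z ∣ ≤ ∥ z ∥
im≤∥∥ (a , b) = le ∣ a ∣ (0≤∣p∣ a) (+-comm ∣ a ∣ ∣ b ∣)

∥·∥ : ∀ z w → ∥ z · w ∥ ≤ ∥ z ∥ * ∥ w ∥
∥·∥ (a , b) (c , d) = subst (∣ a * c - b * d ∣ + ∣ a * d + b * c ∣ ≤_) eq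
  (+-mono-≤ (∣p-q∣≤∣p∣+∣q∣ (a * c) (b * d)) (∣p+q∣≤∣p∣+∣q∣ (a * d) (b * c)))
  where
  eq : ∣ a * c ∣ + ∣ b * d ∣ + (∣ a * d ∣ + ∣ b * c ∣) ≡ (∣ a ∣ + ∣ b ∣) * (∣ c ∣ + ∣ d ∣)
  eq = trans (cong₂ _+_ (cong₂ _+_ (∣p*q∣≡∣p∣*∣q∣ a c) (∣p*q∣≡∣p∣*∣q∣ b d)) (cong₂ _+_ (∣p*q∣≡∣p∣*∣q∣ a d) (∣p*q∣≡∣p∣*∣q∣ b c)))
    (solve 4 (λ a b c d → a :* c :+ b :* d :+ (a :* d :+ b :* c) := (a :+ b) :* (c :+ d)) refl (∣ a ∣) (∣ b ∣) (∣ c ∣) (∣ d ∣))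

absTerm : ℕ → ℚ → ℚ
absTerm zero    B = 1ℚ
absTerm (suc k) B = absTerm k B * B * recip k

0≤absTerm : ∀ k {B} → 0ℚ ≤ B → 0ℚ ≤ absTerm k B
0≤absTerm zero 0≤B = 0≤1
0≤absTerm (suc k) 0≤B = mul0 (mul0 (0≤absTerm k 0≤B) 0≤B) (0≤recip k)

∥expTerm∥ : ∀ k z {B} → ∥ z ∥ ≤ B → ∥ expTerm k z ∥ ≤ absTerm k B
∥expTerm∥ zero z _ = ≤-refl
∥expTerm∥ (suc k) z {B} z≤B = subst (_≤ absTerm k B * B * recip k) (sym eq)
  (mul-mono (0≤∥∥ w) (≤-trans (∥·∥ (expTerm k z) z)
    (mul-mono (0≤∥∥ (expTerm k z)) (∥expTerm∥ k z z≤B) (0≤∥∥ z) z≤B)) (0≤recip k) ≤-refl)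
  where
  w = expTerm k z · z
  eq : ∣ proj₁ w * recip k ∣ + ∣ proj₂ w * recip k ∣ ≡ ∥ w ∥ * recip k
  eq = trans (cong₂ _+_ (scale (proj₁ w)) (scale (proj₂ w))) (sym (*-distribʳ-+ (recip k) (∣ proj₁ w ∣) (∣ proj₂ w ∣)))
    where
    scale : ∀ p → ∣ p * recip k ∣ ≡ ∣ p ∣ * recip k
    scale p = trans (∣p*q∣≡∣p∣*∣q∣ p (recip k)) (cong (∣ p ∣ *_) (0≤p⇒∣p∣≡p (0≤recip k)))

halving : ∀ {B} k → 0ℚ ≤ B → B + B ≤ ι (suc k) → absTerm (suc k) B + absTerm (suc k) B ≤ absTerm k B
halving {B} k 0≤B 2B≤ = subst₂ _≤_
  (solve 3 (λ t b r → t :* ((b :+ b) :* r) := t :* b :* r :+ t :* b :* r) refl (absTerm k B) B (recip k))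
  (trans (cong (absTerm k B *_) (trans (*-comm (ι (suc k)) (recip k)) (recip-ι k))) (*-identityʳ (absTerm k B)))
  (*-monoˡ-≤-nonNeg (absTerm k B) {{nonNegative (0≤absTerm k 0≤B)}}
    (*-monoʳ-≤-nonNeg (recip k) {{nonNegative (0≤recip k)}} 2B≤))

tail : ∀ (u τ t : ℕ → ℚ) → (∀ n → u (suc n) ≡ u n + τ n) → (∀ n → ∣ τ n ∣ ≤ t n) →
       ∀ n → (∀ k → n ℕ.≤ k → t (suc k) + t (suc k) ≤ t k) →
       ∀ j → ∣ u (j ℕ.+ n) - u n ∣ + (t (j ℕ.+ n) + t (j ℕ.+ n)) ≤ t n + t n
tail u τ t us τ≤ n half zero = ≤-reflexive (trans (cong (λ s → ∣ s ∣ + (t n + t n)) (+-inverseʳ (u n))) (+-identityˡ (t n + t n)))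
tail u τ t us τ≤ n half (suc j) = ≤-trans
  (+-mono-≤ (≤-trans split (+-monoʳ-≤ ∣ u m - u n ∣ (τ≤ m))) (half m (ℕP.m≤n+m n j)))
  (subst (_≤ t n + t n) (sym (+-assoc ∣ u m - u n ∣ (t m) (t m))) (tail u τ t us τ≤ n half j))
  where
  m = j ℕ.+ n
  split : ∣ u (suc m) - u n ∣ ≤ ∣ u m - u n ∣ + ∣ τ m ∣
  split rewrite us m = subst (λ s → ∣ s ∣ ≤ ∣ u m - u n ∣ + ∣ τ m ∣)
    (solve 3 (λ x y s → x :- y :+ s := x :+ s :- y) refl (u m) (u n) (τ m)) (∣p+q∣≤∣p∣+∣q∣ (u m - u n) (τ m))

decay : ∀ {B} K → 0ℚ ≤ B → B + B ≤ ι (suc K) → ∀ j → absTerm (j ℕ.+ K) B * ι (suc j) ≤ absTerm K B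
decay K 0≤B 2B≤ zero = ≤-reflexive (*-identityʳ _)
decay {B} K 0≤B 2B≤ (suc j) = ≤-trans
  (le (t′ * ι j) (mul0 (0≤absTerm (suc k) 0≤B) (0≤ι j))
    (trans (solve 2 (λ t i → (t :+ t) :* (con 1ℚ :+ i) := t :* (con 1ℚ :+ (con 1ℚ :+ i)) :+ t :* i) refl t′ (ι j))
      (cong (λ s → t′ * s + t′ * ι j) (sym (trans (ι-suc (suc j)) (cong (λ s → 1ℚ + s) (ι-suc j)))))))
  (≤-trans (subst (λ s → (t′ + t′) * s ≤ absTerm k B * ι (suc j)) (ι-suc j)
      (*-monoʳ-≤-nonNeg (ι (suc j)) {{nonNegative (0≤ι (suc j))}}
        (halving k 0≤B (≤-trans 2B≤ (ι-mono (ℕ.s≤s (ℕP.m≤n+m K j)))))))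
    (decay K 0≤B 2B≤ j))
  where
  k = j ℕ.+ K
  t′ = absTerm (suc k) B

decay′ : ∀ {B} K → 0ℚ ≤ B → B + B ≤ ι (suc K) → ∀ j → absTerm (j ℕ.+ K) B ≤ absTerm K B * recip j
decay′ {B} K 0≤B 2B≤ j = subst (_≤ absTerm K B * recip j)
  (trans (solve 3 (λ t i r → t :* i :* r := t :* (r :* i)) refl (absTerm (j ℕ.+ K) B) (ι (suc j)) (recip j))
    (trans (cong (absTerm (j ℕ.+ K) B *_) (recip-ι j)) (*-identityʳ _)))
  (*-monoʳ-≤-nonNeg (recip j) {{nonNegative (0≤recip j)}} (decay K 0≤B 2B≤ j))

absTerm-small : ∀ {B} ε → 0ℚ ≤ B → 0ℚ < ε → ∃[ N ] (B + B ≤ ι (suc N)) × (∀ n → N ℕ.≤ n → absTerm n B + absTerm n B ≤ ε)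
absTerm-small {B} ε 0≤B 0<ε =
  let K , 2B≤ = archimedean (B + B)
      T = absTerm K B
      2B≤′ = ≤-trans 2B≤ (ι-mono (ℕP.n≤1+n K))
      0≤T = 0≤absTerm K 0≤B
      δ , 0<δ , small = shrink (T + T) ε (add0 0≤T 0≤T) 0<ε
      J , J≤ = small-recip δ 0<δ
  in J ℕ.+ K , ≤-trans 2B≤′ (ι-mono (ℕ.s≤s (ℕP.m≤n+m K J))) , λ n N≤n →
     let j = n ℕ.∸ K
         j+K≡n : j ℕ.+ K ≡ n
         j+K≡n = ℕP.m∸n+n≡m (ℕP.≤-trans (ℕP.m≤n+m K J) N≤n)
         J≤j : J ℕ.≤ j
         J≤j = subst (ℕ._≤ j) (ℕP.m+n∸n≡m J K) (ℕP.∸-monoˡ-≤ K N≤n)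
         one : absTerm n B ≤ T * δ
         one = subst (λ k → absTerm k B ≤ T * δ) j+K≡n (≤-trans (decay′ K 0≤B 2B≤′ j)
                 (*-monoˡ-≤-nonNeg T {{nonNegative 0≤T}} (≤-trans (recip-anti J≤j) J≤)))
     in ≤-trans (+-mono-≤ one one) (subst (_≤ ε) (*-distribʳ-+ δ T T) small)

abstract
  expSum-tail : ∀ B ε → 0ℚ ≤ B → 0ℚ < ε → ∃[ N ] ∀ z → ∥ z ∥ ≤ B → ∀ n → N ℕ.≤ n →
                ∣ proj₁ (expSum n z) - proj₁ (expSum N z) ∣ ≤ ε × ∣ proj₂ (expSum n z) - proj₂ (expSum N z) ∣ ≤ ε
  expSum-tail B ε 0≤B 0<ε =
    let N , 2B≤ , small = absTerm-small ε 0≤B 0<ε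
    in N , λ z z≤B n N≤n →
      let half : ∀ k → N ℕ.≤ k → absTerm (suc k) B + absTerm (suc k) B ≤ absTerm k B
          half k N≤k = halving k 0≤B (≤-trans 2B≤ (ι-mono (ℕ.s≤s N≤k)))
          finish : ∀ u τ → (∀ n → u (suc n) ≡ u n + τ n) → (∀ n → ∣ τ n ∣ ≤ absTerm n B) → ∣ u n - u N ∣ ≤ ε
          finish u τ us τ≤ = subst (λ m → ∣ u m - u N ∣ ≤ ε) (ℕP.m∸n+n≡m N≤n)
            (≤-trans (le {∣ u (n ℕ.∸ N ℕ.+ N) - u N ∣} (t (n ℕ.∸ N ℕ.+ N) + t (n ℕ.∸ N ℕ.+ N)) (add0 (0≤absTerm (n ℕ.∸ N ℕ.+ N) 0≤B) (0≤absTerm (n ℕ.∸ N ℕ.+ N) 0≤B)) refl)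
              (≤-trans (tail u τ t us τ≤ N half (n ℕ.∸ N)) (small N ℕP.≤-refl)))
      in finish (λ k → proj₁ (expSum k z)) (λ k → proj₁ (expTerm k z)) (λ _ → refl) (λ k → ≤-trans (re≤∥∥ (expTerm k z)) (∥expTerm∥ k z z≤B)) ,
         finish (λ k → proj₂ (expSum k z)) (λ k → proj₂ (expTerm k z)) (λ _ → refl) (λ k → ≤-trans (im≤∥∥ (expTerm k z)) (∥expTerm∥ k z z≤B))
    where
    t : ℕ → ℚ
    t k = absTerm k B

Cauchy² : (ℕ → ℚ × ℚ) → Set
Cauchy² z = Cauchy (λ n → proj₁ (z n)) × Cauchy (λ n → proj₂ (z n))

abstract
  expTerm-cauchy : ∀ z → Cauchy² z → ∀ k → Cauchy² (λ n → expTerm k (z n))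
  expTerm-cauchy z c zero = const-cauchy 1ℚ , const-cauchy 0ℚ
  expTerm-cauchy z (c , d) (suc k) =
    *-cauchy {λ n → proj₁ (expTerm k (z n) · z n)} {λ _ → recip k}
      (+-cauchy {λ n → a n * x n} {λ n → - (b n * y n)} (*-cauchy {a} {x} c′ c)
        (neg-cauchy {λ n → b n * y n} (*-cauchy {b} {y} d′ d))) (const-cauchy (recip k)) ,
    *-cauchy {λ n → proj₂ (expTerm k (z n) · z n)} {λ _ → recip k}
      (+-cauchy {λ n → a n * y n} {λ n → b n * x n} (*-cauchy {a} {y} c′ d) (*-cauchy {b} {x} d′ c)) (const-cauchy (recip k))
    where
    x y a b : ℕ → ℚ
    x n = proj₁ (z n)
    y n = proj₂ (z n)
    a n = proj₁ (expTerm k (z n))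
    b n = proj₂ (expTerm k (z n))
    c′ : Cauchy a
    c′ = proj₁ (expTerm-cauchy z (c , d) k)
    d′ : Cauchy b
    d′ = proj₂ (expTerm-cauchy z (c , d) k)

abstract
  expSum-cauchy : ∀ z → Cauchy² z → ∀ N → Cauchy² (λ n → expSum N (z n))
  expSum-cauchy z c zero = const-cauchy 0ℚ , const-cauchy 0ℚ
  expSum-cauchy z c (suc N) =
    +-cauchy {λ n → proj₁ (expSum N (z n))} {λ n → proj₁ (expTerm N (z n))}
      (proj₁ (expSum-cauchy z c N)) (proj₁ (expTerm-cauchy z c N)) ,
    +-cauchy {λ n → proj₂ (expSum N (z n))} {λ n → proj₂ (expTerm N (z n))}
      (proj₂ (expSum-cauchy z c N)) (proj₂ (expTerm-cauchy z c N))

abstract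
  exp-cauchy : ∀ z → Cauchy² z → Cauchy² (λ n → expSum n (z n))
  exp-cauchy z (c , d) =
    let A , 0≤A , x≤A = bounded {λ n → proj₁ (z n)} c
        B , 0≤B , y≤B = bounded {λ n → proj₂ (z n)} d
        bound : ∀ n → ∥ z n ∥ ≤ A + B
        bound n = +-mono-≤ (x≤A n) (y≤B n)
    in approx-cauchy {λ n → proj₁ (expSum n (z n))} (λ ε 0<ε → let N , close = expSum-tail (A + B) ε (add0 0≤A 0≤B) 0<ε in
         (λ n → proj₁ (expSum N (z n))) , proj₁ (expSum-cauchy z (c , d) N) , N , λ n N≤n → proj₁ (close (z n) (bound n) n N≤n)) ,
       approx-cauchy {λ n → proj₂ (expSum n (z n))} (λ ε 0<ε → let N , close = expSum-tail (A + B) ε (add0 0≤A 0≤B) 0<ε in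
         (λ n → proj₂ (expSum N (z n))) , proj₂ (expSum-cauchy z (c , d) N) , N , λ n N≤n → proj₂ (close (z n) (bound n) n N≤n))

record ℝ : Set where
  constructor mkℝ
  field
    seq    : ℕ → ℚ
    cauchy : Cauchy seq
open ℝ public

infix  4 _≈ʳ_
infixl 6 _+ʳ_
infixl 7 _*ʳ_
infix  8 -ʳ_

_≈ʳ_ : ℝ → ℝ → Set
x ≈ʳ y = ∀ ε → 0ℚ < ε → ∃[ N ] ∀ n → N ℕ.≤ n → ∣ seq x n - seq y n ∣ ≤ ε

fromℚ : ℚ → ℝ
fromℚ q = mkℝ (λ _ → q) (const-cauchy q)

_+ʳ_ _*ʳ_ : ℝ → ℝ → ℝ
x +ʳ y = mkℝ (λ n → seq x n + seq y n) (+-cauchy {seq x} {seq y} (cauchy x) (cauchy y))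
x *ʳ y = mkℝ (λ n → seq x n * seq y n) (*-cauchy {seq x} {seq y} (cauchy x) (cauchy y))

-ʳ_ : ℝ → ℝ
-ʳ x = mkℝ (λ n → - seq x n) (neg-cauchy {seq x} (cauchy x))

-- inv 0 = 0, but only finitely many terms of a sequence apart from 0 vanish
invʳ : (x : ℝ) → Apart (seq x) → ℝ
invʳ x x#0 = mkℝ (λ n → inv (seq x n)) (inv-cauchy {seq x} (cauchy x) x#0)

2ℚ 5ℚ 12ℚ : ℚ
2ℚ = + 2 / 1
5ℚ = + 5 / 1
12ℚ = + 12 / 1

square-5 : ℕ → ℚ → ℚ
square-5 _ q = q * q - 5ℚ

abstract
  square-5-increasing : Increasing square-5 2ℚ
  square-5-increasing = record
    { C = 1ℚ ; 0≤C = 0≤1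
    ; slope = λ n x y 2≤x x≤y _ → le
        ((y - x) * (x - 2ℚ + (x - 2ℚ) + (y - x) + + 3 / 1))
        (mul0 (gap x≤y) (add0 (add0 (add0 (gap 2≤x) (gap 2≤x)) (gap x≤y)) (nonNegative⁻¹ (+ 3 / 1))))
        (solve 2 (λ x y → con 1ℚ :* (y :* y :- con 5ℚ :- (x :* x :- con 5ℚ)) :=
           y :- x :+ (y :- x) :* (x :- con 2ℚ :+ (x :- con 2ℚ) :+ (y :- x) :+ con (+ 3 / 1))) refl x y)
    ; unif = λ ε 0<ε → 0 , λ _ _ _ _ q _ _ → le ε (<⇒≤ 0<ε) refl
    }

√5 : ℝ
√5 = mkℝ (rootSeq square-5 2ℚ) (root-cauchy square-5 2ℚ square-5-increasing)

abstract
  √5#0 : Apart (seq √5)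
  √5#0 = 2ℚ , positive⁻¹ 2ℚ , 0 , λ n _ → ≤-trans (a≤root square-5 2ℚ n) (p≤∣p∣ (seq √5 n))

φ : ℝ
φ = (fromℚ 1ℚ +ʳ √5) *ʳ fromℚ ½

near⇒≤ : ∀ {e} s c t → ∣ s - c ∣ ≤ e → ∣ t - c ∣ ≤ e → s ≤ t + (e + e)
near⇒≤ {e} s c t sc tc = le (e - (s - c) + (e - (c - t)))
  (add0 (gap (≤-trans (p≤∣p∣ (s - c)) sc)) (gap (≤-trans (p≤∣p∣ (c - t)) (subst (_≤ e) (∣-∣-sym t c) tc))))
  (solve 4 (λ s c t e → t :+ (e :+ e) := s :+ (e :- (s :- c) :+ (e :- (c :- t)))) refl s c t e)

expRe-mono : ∀ k {x y} → 0ℚ ≤ x → x ≤ y →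
             0ℚ ≤ proj₁ (expTerm k (x , 0ℚ)) × proj₁ (expTerm k (x , 0ℚ)) ≤ proj₁ (expTerm k (y , 0ℚ))
expRe-mono zero _ _ = 0≤1 , ≤-refl
expRe-mono (suc k) {x} {y} 0≤x x≤y =
  let 0≤t , t≤ = expRe-mono k 0≤x x≤y
  in subst (0ℚ ≤_) (sym (step x)) (mul0 (mul0 0≤t 0≤x) (0≤recip k)) ,
     subst₂ _≤_ (sym (step x)) (sym (step y)) (mul-mono (mul0 0≤t 0≤x) (mul-mono 0≤t t≤ 0≤x x≤y) (0≤recip k) ≤-refl)
  where
  step : ∀ q → proj₁ (expTerm (suc k) (q , 0ℚ)) ≡ proj₁ (expTerm k (q , 0ℚ)) * q * recip k
  step q = solve 4 (λ a b q r → (a :* q :- b :* con 0ℚ) :* r := a :* q :* r) refl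
    (proj₁ (expTerm k (q , 0ℚ))) (proj₂ (expTerm k (q , 0ℚ))) q (recip k)

-- starting from two terms of the series makes every member strictly increasing
exp-minus-φ : ℕ → ℚ → ℚ
exp-minus-φ n q = proj₁ (expSum (2 ℕ.+ n) (q , 0ℚ)) - seq φ n

exp-slope : ∀ n x y → 0ℚ ≤ x → x ≤ y →
            y - x ≤ proj₁ (expSum (2 ℕ.+ n) (y , 0ℚ)) - proj₁ (expSum (2 ℕ.+ n) (x , 0ℚ))
exp-slope zero x y _ _ = ≤-reflexive (solve 2 (λ x y → y :- x :=
    con 0ℚ :+ con 1ℚ :+ (con 1ℚ :* y :- con 0ℚ :* con 0ℚ) :* con 1ℚ :-
    (con 0ℚ :+ con 1ℚ :+ (con 1ℚ :* x :- con 0ℚ :* con 0ℚ) :* con 1ℚ)) refl x y)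
exp-slope (suc n) x y 0≤x x≤y = ≤-trans (exp-slope n x y 0≤x x≤y)
  (le (ty - tx) (gap (proj₂ (expRe-mono (2 ℕ.+ n) 0≤x x≤y)))
    (solve 4 (λ a b s t → a :+ s :- (b :+ t) := a :- b :+ (s :- t)) refl
      (proj₁ (expSum (2 ℕ.+ n) (y , 0ℚ))) (proj₁ (expSum (2 ℕ.+ n) (x , 0ℚ))) ty tx))
  where
  tx = proj₁ (expTerm (2 ℕ.+ n) (x , 0ℚ))
  ty = proj₁ (expTerm (2 ℕ.+ n) (y , 0ℚ))

abstract
  exp-minus-φ-increasing : Increasing exp-minus-φ 0ℚ
  exp-minus-φ-increasing = record
    { C = 1ℚ ; 0≤C = 0≤1
    ; slope = λ n x y 0≤x x≤y _ → subst (y - x ≤_)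
        (solve 3 (λ a b f → a :- b := con 1ℚ :* (a :- f :- (b :- f))) refl
          (proj₁ (expSum (2 ℕ.+ n) (y , 0ℚ))) (proj₁ (expSum (2 ℕ.+ n) (x , 0ℚ))) (seq φ n))
        (exp-slope n x y 0≤x x≤y)
    ; unif = λ ε 0<ε →
        let h   = ε * ½ * ½
            0<h = half-pos (half-pos 0<ε)
            N , close = expSum-tail 1ℚ h 0≤1 0<h
            M , near  = cauchy φ (ε * ½) (half-pos 0<ε)
        in N ℕ.⊔ M , λ m n p q x 0≤x x≤1 →
           let m≥N = ℕP.m⊔n≤o⇒m≤o N M p ; n≥N = ℕP.m⊔n≤o⇒m≤o N M q
               bound : ∥ (x , 0ℚ) ∥ ≤ 1ℚ
               bound = subst (_≤ 1ℚ) (sym (trans (+-identityʳ ∣ x ∣) (0≤p⇒∣p∣≡p 0≤x))) x≤1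
               up : ∀ {k} → N ℕ.≤ k → N ℕ.≤ 2 ℕ.+ k
               up N≤k = ℕP.m≤n⇒m≤1+n (ℕP.m≤n⇒m≤1+n N≤k)
           in finish {ε} (proj₁ (expSum (2 ℕ.+ n) (x , 0ℚ))) (proj₁ (expSum (2 ℕ.+ m) (x , 0ℚ))) (seq φ n) (seq φ m)
                (near⇒≤ {h} (proj₁ (expSum (2 ℕ.+ n) (x , 0ℚ))) (proj₁ (expSum N (x , 0ℚ))) (proj₁ (expSum (2 ℕ.+ m) (x , 0ℚ)))
                  (proj₁ (close (x , 0ℚ) bound (2 ℕ.+ n) (up n≥N))) (proj₁ (close (x , 0ℚ) bound (2 ℕ.+ m) (up m≥N))))
                (near m n (ℕP.m⊔n≤o⇒n≤o N M p) (ℕP.m⊔n≤o⇒n≤o N M q))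
    }
    where
    finish : ∀ {ε} s t u v → s ≤ t + (ε * ½ * ½ + ε * ½ * ½) → ∣ v - u ∣ ≤ ε * ½ → s - u ≤ t - v + ε
    finish {ε} s t u v s≤ vu = le (t + (ε * ½ * ½ + ε * ½ * ½) - s + (ε * ½ - (v - u)))
      (add0 (gap s≤) (gap (≤-trans (p≤∣p∣ (v - u)) vu)))
      (solve 5 (λ s t u v e → t :- v :+ e := s :- u :+ (t :+ (e :* con ½ :* con ½ :+ e :* con ½ :* con ½) :- s :+ (e :* con ½ :- (v :- u)))) refl s t u v ε)

logφ : ℝ
logφ = mkℝ (rootSeq exp-minus-φ 0ℚ) (root-cauchy exp-minus-φ 0ℚ exp-minus-φ-increasing)

-- cosSum n q is the real part of Σ_{k<4n+2} (iq)^k / k!, i.e. the first 2n + 1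
-- nonzero terms of the cosine series
cosSum : ℕ → ℚ → ℚ
cosSum n q = proj₁ (expSum (n ℕ.* 4 ℕ.+ 2) (0ℚ , q))

σ : ℕ → ℚ
σ k = recip k * recip (suc k)

0≤σ : ∀ k → 0ℚ ≤ σ k
0≤σ k = mul0 (0≤recip k) (0≤recip (suc k))

β : ℕ → ℚ → ℚ
β zero    u = ½
β (suc n) u = β n u * (u * u) * (σ (n ℕ.* 4 ℕ.+ 2) * σ (2 ℕ.+ (n ℕ.* 4 ℕ.+ 2)))

β-mono : ∀ n {u v} → 0ℚ ≤ u → u ≤ v → 0ℚ ≤ β n u × β n u ≤ β n v
β-mono zero _ _ = nonNegative⁻¹ ½ , ≤-refl
β-mono (suc n) {u} {v} 0≤u u≤v =
  let 0≤b , b≤ = β-mono n 0≤u u≤v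
      0≤s = mul0 (0≤σ (n ℕ.* 4 ℕ.+ 2)) (0≤σ (2 ℕ.+ (n ℕ.* 4 ℕ.+ 2)))
      0≤uu = mul0 0≤u 0≤u
  in mul0 (mul0 0≤b 0≤uu) 0≤s ,
     mul-mono (mul0 0≤b 0≤uu) (mul-mono 0≤b b≤ 0≤uu (mul-mono 0≤u u≤v 0≤u u≤v)) 0≤s ≤-refl

termRe termIm : ℕ → ℚ → ℚ
termRe k q = proj₁ (expTerm k (0ℚ , q))
termIm k q = proj₂ (expTerm k (0ℚ , q))

termRe-suc² : ∀ k q → termRe (suc (suc k)) q ≡ - (termRe k q * (q * q) * σ k)
termRe-suc² k q = solve 5 (λ a b q r s →
    ((a :* con 0ℚ :- b :* q) :* r :* con 0ℚ :- (a :* q :+ b :* con 0ℚ) :* r :* q) :* s := :- (a :* (q :* q) :* (r :* s)))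
  refl (termRe k q) (termIm k q) q (recip k) (recip (suc k))

termIm-suc² : ∀ k q → termIm k q ≡ 0ℚ → termIm (suc (suc k)) q ≡ 0ℚ
termIm-suc² k q eq = trans
  (solve 5 (λ a b q r s → ((a :* con 0ℚ :- b :* q) :* r :* q :+ (a :* q :+ b :* con 0ℚ) :* r :* con 0ℚ) :* s := b :* (:- (q :* q :* r :* s)))
    refl (termRe k q) (termIm k q) q (recip k) (recip (suc k)))
  (trans (cong (_* (- (q * q * recip k * recip (suc k)))) eq) (*-zeroˡ (- (q * q * recip k * recip (suc k)))))

termRe-odd : ∀ k q → termIm k q ≡ 0ℚ → termRe (suc k) q ≡ 0ℚ
termRe-odd k q eq = trans
  (solve 4 (λ a b q r → (a :* con 0ℚ :- b :* q) :* r := b :* (:- (q :* r))) refl (termRe k q) (termIm k q) q (recip k))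
  (trans (cong (_* (- (q * recip k))) eq) (*-zeroˡ (- (q * recip k))))

termIm-even : ∀ n q → termIm (n ℕ.* 4 ℕ.+ 2) q ≡ 0ℚ
termIm-even zero q = termIm-suc² 0 q refl
termIm-even (suc n) q = termIm-suc² (2 ℕ.+ p) q (termIm-suc² p q (termIm-even n q))
  where p = n ℕ.* 4 ℕ.+ 2

termRe-even : ∀ n q → termRe (n ℕ.* 4 ℕ.+ 2) q ≡ - (q * q * β n (q * q))
termRe-even zero q = trans (termRe-suc² 0 q) (solve 1 (λ q → :- (con 1ℚ :* (q :* q) :* con ½) := :- (q :* q :* con ½)) refl q)
termRe-even (suc n) q = trans (termRe-suc² (2 ℕ.+ p) q) (trans
  (cong (λ t → - (t * (q * q) * σ (2 ℕ.+ p))) (trans (termRe-suc² p q) (cong (λ t → - (t * (q * q) * σ p)) (termRe-even n q))))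
  (solve 4 (λ u b s t → :- ((:- ((:- (u :* b)) :* u :* s)) :* u :* t) := :- (u :* (b :* (u :* u) :* (s :* t)))) refl
    (q * q) (β n (q * q)) (σ p) (σ (2 ℕ.+ p))))
  where p = n ℕ.* 4 ℕ.+ 2

drop : ℕ → ℚ → ℚ
drop n u = β n u * (u * (1ℚ - u * σ (n ℕ.* 4 ℕ.+ 2)))

cosSum-suc : ∀ n q → cosSum (suc n) q ≡ cosSum n q - drop n (q * q)
cosSum-suc n q = trans
  (cong₂ (λ s t → cosSum n q + termRe p q + s + termRe (2 ℕ.+ p) q + t) (termRe-odd p q (termIm-even n q))
    (termRe-odd (2 ℕ.+ p) q (termIm-suc² p q (termIm-even n q))))
  (trans (cong₂ (λ s t → cosSum n q + s + 0ℚ + t + 0ℚ) (termRe-even n q)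
           (trans (termRe-suc² p q) (cong (λ t → - (t * (q * q) * σ p)) (termRe-even n q))))
    (solve 4 (λ c u b s → c :+ (:- (u :* b)) :+ con 0ℚ :+ (:- ((:- (u :* b)) :* u :* s)) :+ con 0ℚ := c :- b :* (u :* (con 1ℚ :- u :* s)))
      refl (cosSum n q) (q * q) (β n (q * q)) (σ p)))
  where p = n ℕ.* 4 ℕ.+ 2

σ≤ : ∀ n → σ (n ℕ.* 4 ℕ.+ 2) ≤ + 1 / 12
σ≤ n = mul-mono (0≤recip p) (recip-anti 2≤p) (0≤recip (suc p)) (recip-anti (ℕ.s≤s 2≤p))
  where
  p = n ℕ.* 4 ℕ.+ 2
  2≤p : 2 ℕ.≤ p
  2≤p = ℕP.m≤n+m 2 (n ℕ.* 4)

4ℚ 8ℚ : ℚ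
4ℚ = + 4 / 1
8ℚ = + 8 / 1

-- the slope of u * (1 - u * s) on [0 , 4] is at least a third when s ≤ 1/12
slack : ∀ {u v s} → 0ℚ ≤ s → s ≤ + 1 / 12 → u ≤ v → v ≤ 4ℚ →
        (v - u) * (+ 1 / 3) ≤ v * (1ℚ - v * s) - u * (1ℚ - u * s)
slack {u} {v} {s} 0≤s s≤ u≤v v≤4 = le ((v - u) * (8ℚ * (+ 1 / 12 - s) + ((4ℚ - u) + (4ℚ - v)) * s))
  (mul0 (gap u≤v) (add0 (mul0 (nonNegative⁻¹ 8ℚ) (gap s≤)) (mul0 (add0 (gap (≤-trans u≤v v≤4)) (gap v≤4)) 0≤s)))
  (solve 3 (λ u v s → v :* (con 1ℚ :- v :* s) :- u :* (con 1ℚ :- u :* s) :=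
     (v :- u) :* con (+ 1 / 3) :+ (v :- u) :* (con 8ℚ :* (con (+ 1 / 12) :- s) :+ ((con 4ℚ :- u) :+ (con 4ℚ :- v)) :* s)) refl u v s)

drop-mono : ∀ n {u v} → 0ℚ ≤ u → u ≤ v → v ≤ 4ℚ → drop n u ≤ drop n v
drop-mono n {u} {v} 0≤u u≤v v≤4 =
  let 0≤b , b≤ = β-mono n 0≤u u≤v
  in mul-mono 0≤b b≤ (mul0 0≤u 0≤1-us) (le (v * (1ℚ - v * s) - u * (1ℚ - u * s))
       (≤-trans (mul0 (gap u≤v) (nonNegative⁻¹ (+ 1 / 3))) (slack (0≤σ p) (σ≤ n) u≤v v≤4))
       (solve 2 (λ a b → b := a :+ (b :- a)) refl (u * (1ℚ - u * s)) (v * (1ℚ - v * s))))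
  where
  p = n ℕ.* 4 ℕ.+ 2
  s = σ p
  0≤1-us : 0ℚ ≤ 1ℚ - u * s
  0≤1-us = gap {u * s} {1ℚ} (≤-trans (mul-mono 0≤u (≤-trans u≤v v≤4) (0≤σ p) (σ≤ n)) (≤ᵇ⇒≤ {4ℚ * (+ 1 / 12)} {1ℚ} _))

cosSum-0 : ∀ q → cosSum 0 q ≡ 1ℚ
cosSum-0 q = solve 1 (λ q → con 0ℚ :+ con 1ℚ :+ (con 1ℚ :* con 0ℚ :- con 0ℚ :* q) :* con 1ℚ := con 1ℚ) refl q

cosSum-slope : ∀ n x y → 1ℚ ≤ x → x ≤ y → y ≤ 2ℚ → y - x ≤ 12ℚ * (cosSum (suc n) x - cosSum (suc n) y)
cosSum-slope n x y 1≤x x≤y y≤2 = go n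
  where
  0≤x : 0ℚ ≤ x
  0≤x = ≤-trans 0≤1 1≤x
  u = x * x
  v = y * y
  0≤u : 0ℚ ≤ u
  0≤u = mul0 0≤x 0≤x
  u≤v : u ≤ v
  u≤v = mul-mono 0≤x x≤y 0≤x x≤y
  v≤4 : v ≤ 4ℚ
  v≤4 = mul-mono (≤-trans 0≤x x≤y) y≤2 (≤-trans 0≤x x≤y) y≤2
  first : y - x ≤ 12ℚ * (drop 0 v - drop 0 u)
  first = ≤-trans
    (le ((y - x) * ((x - 1ℚ) + (x - 1ℚ) + (y - x) + 1ℚ) + (v - u))
      (add0 (mul0 (gap x≤y) (add0 (add0 (add0 (gap 1≤x) (gap 1≤x)) (gap x≤y)) 0≤1)) (gap u≤v))
      (solve 2 (λ x y → con (+ 6 / 1) :* ((y :* y :- x :* x) :* con (+ 1 / 3)) :=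
         y :- x :+ ((y :- x) :* ((x :- con 1ℚ) :+ (x :- con 1ℚ) :+ (y :- x) :+ con 1ℚ) :+ (y :* y :- x :* x))) refl x y))
    (≤-trans (*-monoˡ-≤-nonNeg (+ 6 / 1) (slack (0≤σ 2) (σ≤ 0) u≤v v≤4))
      (≤-reflexive (solve 2 (λ a b → con (+ 6 / 1) :* (a :- b) := con 12ℚ :* (con ½ :* a :- con ½ :* b)) refl
        (v * (1ℚ - v * σ 2)) (u * (1ℚ - u * σ 2)))))
  go : ∀ n → y - x ≤ 12ℚ * (cosSum (suc n) x - cosSum (suc n) y)
  go zero = subst (λ t → y - x ≤ 12ℚ * t) (sym (trans
    (cong₂ _-_ (trans (cosSum-suc 0 x) (cong (_- drop 0 u) (cosSum-0 x))) (trans (cosSum-suc 0 y) (cong (_- drop 0 v) (cosSum-0 y))))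
    (solve 2 (λ a b → con 1ℚ :- a :- (con 1ℚ :- b) := b :- a) refl (drop 0 u) (drop 0 v)))) first
  go (suc n) = ≤-trans (go n) (*-monoˡ-≤-nonNeg 12ℚ
    (le {cosSum (suc n) x - cosSum (suc n) y} {cosSum (2 ℕ.+ n) x - cosSum (2 ℕ.+ n) y}
      (drop (suc n) v - drop (suc n) u) (gap (drop-mono (suc n) 0≤u u≤v v≤4))
      (trans (cong₂ _-_ (cosSum-suc (suc n) x) (cosSum-suc (suc n) y))
        (solve 4 (λ a b s t → a :- s :- (b :- t) := a :- b :+ (t :- s)) refl
          (cosSum (suc n) x) (cosSum (suc n) y) (drop (suc n) u) (drop (suc n) v)))))

-- indices start at 1 because cosSum 0 is constant
neg-cos : ℕ → ℚ → ℚ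
neg-cos n q = - cosSum (suc n) q

abstract
  neg-cos-increasing : Increasing neg-cos 1ℚ
  neg-cos-increasing = record
    { C = 12ℚ ; 0≤C = nonNegative⁻¹ 12ℚ
    ; slope = λ n x y 1≤x x≤y y≤2 → subst (λ t → y - x ≤ 12ℚ * t)
        (solve 2 (λ a b → a :- b := :- b :- (:- a)) refl (cosSum (suc n) x) (cosSum (suc n) y))
        (cosSum-slope n x y 1≤x x≤y y≤2)
    ; unif = λ ε 0<ε →
        let N , close = expSum-tail 2ℚ (ε * ½) (nonNegative⁻¹ 2ℚ) (half-pos 0<ε)
        in N , λ m n N≤m N≤n q 1≤q q≤2 →
           let bound : ∥ (0ℚ , q) ∥ ≤ 2ℚ
               bound = subst (_≤ 2ℚ) (sym (trans (+-identityˡ ∣ q ∣) (0≤p⇒∣p∣≡p (≤-trans 0≤1 1≤q)))) q≤2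
               up : ∀ k → N ℕ.≤ k → N ℕ.≤ suc k ℕ.* 4 ℕ.+ 2
               up k N≤k = ℕP.≤-trans N≤k (ℕP.≤-trans (ℕP.n≤1+n k) (ℕP.≤-trans (ℕP.m≤m*n (suc k) 4) (ℕP.m≤m+n (suc k ℕ.* 4) 2)))
           in flip {ε} (cosSum (suc m) q) (cosSum (suc n) q)
                (near⇒≤ {ε * ½} (cosSum (suc m) q) (proj₁ (expSum N (0ℚ , q))) (cosSum (suc n) q)
                  (proj₁ (close (0ℚ , q) bound (suc m ℕ.* 4 ℕ.+ 2) (up m N≤m)))
                  (proj₁ (close (0ℚ , q) bound (suc n ℕ.* 4 ℕ.+ 2) (up n N≤n))))
    }
    where
    flip : ∀ {ε} s t → s ≤ t + (ε * ½ + ε * ½) → - t ≤ - s + ε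
    flip {ε} s t s≤ = le (t + (ε * ½ + ε * ½) - s) (gap s≤)
      (solve 3 (λ s t e → :- s :+ e := :- t :+ (t :+ (e :* con ½ :+ e :* con ½) :- s)) refl s t ε)

-- twice the zero of the cosine in [1 , 2]
π : ℝ
π = fromℚ 2ℚ *ʳ mkℝ (rootSeq neg-cos 1ℚ) (root-cauchy neg-cos 1ℚ neg-cos-increasing)

record ℂ : Set where
  constructor mkℂ
  field
    re im : ℝ
open ℂ public

infix  4 _≈ᶜ_
infixl 6 _+ᶜ_ _-ᶜ_
infixl 7 _*ᶜ_
infix  8 -ᶜ_

_≈ᶜ_ : ℂ → ℂ → Set
z ≈ᶜ w = re z ≈ʳ re w × im z ≈ʳ im w

fromℝ : ℝ → ℂ
fromℝ x = mkℂ x (fromℚ 0ℚ)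

1ᶜ 2ᶜ 𝕚 : ℂ
1ᶜ = fromℝ (fromℚ 1ℚ)
2ᶜ = fromℝ (fromℚ 2ℚ)
𝕚  = mkℂ (fromℚ 0ℚ) (fromℚ 1ℚ)

_+ᶜ_ _*ᶜ_ : ℂ → ℂ → ℂ
z +ᶜ w = mkℂ (re z +ʳ re w) (im z +ʳ im w)
z *ᶜ w = mkℂ (re z *ʳ re w +ʳ -ʳ (im z *ʳ im w)) (re z *ʳ im w +ʳ im z *ʳ re w)

-ᶜ_ : ℂ → ℂ
-ᶜ z = mkℂ (-ʳ re z) (-ʳ im z)

_-ᶜ_ : ℂ → ℂ → ℂ
z -ᶜ w = z +ᶜ (-ᶜ w)

-- The nth approximation sums n terms of the series at the nth rational
-- approximation of z; the series converges uniformly on bounded sets.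
exp : ℂ → ℂ
exp z = mkℂ (mkℝ (λ n → proj₁ (expSum n (approx n))) (proj₁ (exp-cauchy approx (cauchy (re z) , cauchy (im z)))))
            (mkℝ (λ n → proj₂ (expSum n (approx n))) (proj₂ (exp-cauchy approx (cauchy (re z) , cauchy (im z)))))
  where
  approx : ℕ → ℚ × ℚ
  approx n = seq (re z) n , seq (im z) n

[-1]^_ φ^_ [-φ]^_ : ℂ → ℂ
[-1]^ n = exp (𝕚 *ᶜ fromℝ π *ᶜ n)
φ^ n    = exp (n *ᶜ fromℝ logφ)
[-φ]^ n = ([-1]^ n) *ᶜ (φ^ n)

_/√5 : ℂ → ℂ
z /√5 = z *ᶜ fromℝ (invʳ √5 √5#0)

Θ : ℂ → ℂ
Θ n = ((φ^ n) -ᶜ ([-φ]^ (-ᶜ n))) /√5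

Ω : ℂ → ℂ → ℂ → ℂ
Ω η γ n = η *ᶜ ([-1]^ (n -ᶜ 1ᶜ)) *ᶜ Θ n +ᶜ γ *ᶜ ([-1]^ n) *ᶜ Θ (n -ᶜ 1ᶜ) *ᶜ fromℝ φ

-- A function ℂ → ℂ is one that respects the equality of ℂ.
record IsCompleteNFeSequence (ω : ℂ → ℂ) : Set where
  field
    respects-≈ : Congruent _≈ᶜ_ _≈ᶜ_ ω
    recurrence : ∀ n → ω n ≈ᶜ ω (n -ᶜ 2ᶜ) -ᶜ ω (n -ᶜ 1ᶜ)

{-# OPTIONS --safe #-}

-- The product of the partial sums of exp at z and at w contains all products of terms that make up the partial sum
-- at z + w, and the superfluous ones are dominated by a tail of the real series at |z| + |w|; hence
-- exp (z + w) = exp z exp w.  The constants log φ and π / 2 being zeros of e^q - φ and cos q, exp (log φ) = φ and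
-- exp (i π / 2) = i s for a real s, so 1 = exp (i π / 2) exp (- i π / 2) = s² and exp (i π) = - s² = -1.  It follows that
-- (-1)^(n - 1) = - (-1)^n and, by φ² = φ + 1, that Θ(n) = Θ(n - 1) + Θ(n - 2).  Substituting both into Ω gives the recurrence.
module Submission where

open import Algebra.Bundles using (CommutativeRing)
import Algebra.Solver.Ring as RingSolver
open import Algebra.Solver.Ring.AlmostCommutativeRing using (fromCommutativeRing; _-Raw-AlmostCommutative⟶_)
open import Data.Integer.Base using (+_)
open import Data.Maybe.Base using (map)
open import Data.Nat as ℕ using (ℕ; zero; suc)
import Data.Nat.Properties as ℕP
open import Data.Product using (_×_; _,_; proj₁; proj₂; ∃-syntax)
open import Data.Product.Properties using (≡-dec)
open import Data.Rational as ℚ using (ℚ)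
open import Data.Rational.Properties using (+-*-commutativeRing)
open import Data.Rational.Solver using (module +-*-Solver)
open import Data.Sum using (_⊎_; inj₁; inj₂)
open import Defs
open import Function using (_∘_)
open import Level using (0ℓ)
open import Relation.Binary.Consequences using (dec⇒weaklyDec)
open import Relation.Binary.PropositionalEquality using (_≡_; cong)

-- The constants are given only as outcomes of a grid search, which at index n uses the nth
-- approximating function and mesh 1 / (n + 1). That the limit is a zero rests on two facts that
-- hold for every n: the approximating functions have the right signs at both ends of the interval,
-- so the search stops beside a change of sign or at an exact zero; and on the range concerned they
-- are Lipschitz with a constant independent of n, so the value found is at most a constant times
-- the mesh. The same kind of uniform bound shows that `exp` respects equality, although each index
-- of `exp z` evaluates a different polynomial. The searches for log φ and π / 2 use more terms of
-- the series than `exp` does at the same index; the discrepancy is dominated by a block of a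
-- convergent real series. Exact identities are checked at each index in ℚ(i), whose ring structure
-- is lifted to ℂ pointwise.

-- Finite convolutions and the recursion of the exponential series

module CauchyProduct {c ℓ} (R : CommutativeRing c ℓ) where
  open CommutativeRing R
  open import Algebra.Properties.Ring ring using (-‿+-comm; -‿distribʳ-*)
  open import Algebra.Solver.Ring.NaturalCoefficients.Default commutativeSemiring
  open import Relation.Binary.Reasoning.Setoid setoid

  -- The sum of a i b (n - i) over i ≤ n; shifting only `a` avoids truncated subtraction.
  conv : (ℕ → Carrier) → (ℕ → Carrier) → ℕ → Carrier
  conv a b zero    = a 0 * b 0
  conv a b (suc n) = a 0 * b (suc n) + conv (a ∘ suc) b n

  sum : (ℕ → Carrier) → ℕ → Carrier
  sum a zero    = 0#
  sum a (suc n) = sum a n + a n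

  conv-cong : ∀ {a a′ b b′} → (∀ i → a i ≈ a′ i) → (∀ i → b i ≈ b′ i) → ∀ n → conv a b n ≈ conv a′ b′ n
  conv-cong p q zero    = *-cong (p 0) (q 0)
  conv-cong p q (suc n) = +-cong (*-cong (p 0) (q (suc n))) (conv-cong (p ∘ suc) q n)

  conv-+ˡ : ∀ a a′ b n → conv (λ i → a i + a′ i) b n ≈ conv a b n + conv a′ b n
  conv-+ˡ a a′ b zero    = distribʳ (b 0) (a 0) (a′ 0)
  conv-+ˡ a a′ b (suc n) = trans (+-congˡ (conv-+ˡ (a ∘ suc) (a′ ∘ suc) b n))
    (solve 5 (λ x y z u v → (x :+ y) :* z :+ (u :+ v) := (x :* z :+ u) :+ (y :* z :+ v)) refl
      (a 0) (a′ 0) (b (suc n)) (conv (a ∘ suc) b n) (conv (a′ ∘ suc) b n))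

  conv-+ʳ : ∀ a b b′ n → conv a (λ i → b i + b′ i) n ≈ conv a b n + conv a b′ n
  conv-+ʳ a b b′ zero    = distribˡ (a 0) (b 0) (b′ 0)
  conv-+ʳ a b b′ (suc n) = trans (+-congˡ (conv-+ʳ (a ∘ suc) b b′ n))
    (solve 5 (λ x y z u v → x :* (y :+ z) :+ (u :+ v) := (x :* y :+ u) :+ (x :* z :+ v)) refl
      (a 0) (b (suc n)) (b′ (suc n)) (conv (a ∘ suc) b n) (conv (a ∘ suc) b′ n))

  conv-*ˡ : ∀ x a b n → conv (λ i → x * a i) b n ≈ x * conv a b n
  conv-*ˡ x a b zero    = *-assoc x (a 0) (b 0)
  conv-*ˡ x a b (suc n) = trans (+-congˡ (conv-*ˡ x (a ∘ suc) b n))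
    (solve 4 (λ x y z u → x :* y :* z :+ x :* u := x :* (y :* z :+ u)) refl x (a 0) (b (suc n)) (conv (a ∘ suc) b n))

  conv-*ʳ : ∀ x a b n → conv a (λ i → x * b i) n ≈ x * conv a b n
  conv-*ʳ x a b zero    = solve 3 (λ x y z → y :* (x :* z) := x :* (y :* z)) refl x (a 0) (b 0)
  conv-*ʳ x a b (suc n) = trans (+-congˡ (conv-*ʳ x (a ∘ suc) b n))
    (solve 4 (λ x y z u → y :* (x :* z) :+ x :* u := x :* (y :* z :+ u)) refl x (a 0) (b (suc n)) (conv (a ∘ suc) b n))

  conv-negʳ : ∀ a b n → conv a (λ i → - b i) n ≈ - conv a b n
  conv-negʳ a b zero    = sym (-‿distribʳ-* (a 0) (b 0))
  conv-negʳ a b (suc n) = trans (+-cong (sym (-‿distribʳ-* (a 0) (b (suc n)))) (conv-negʳ (a ∘ suc) b n))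
    (-‿+-comm (a 0 * b (suc n)) (conv (a ∘ suc) b n))

  conv-sucʳ : ∀ a b n → conv a b (suc n) ≈ conv a (b ∘ suc) n + a (suc n) * b 0
  conv-sucʳ a b zero    = refl
  conv-sucʳ a b (suc n) = trans (+-congˡ (conv-sucʳ (a ∘ suc) b n)) (sym (+-assoc _ _ _))

  sum-sucˡ : ∀ a n → sum a (suc n) ≈ a 0 + sum (a ∘ suc) n
  sum-sucˡ a zero    = +-comm 0# (a 0)
  sum-sucˡ a (suc n) = trans (+-congʳ (sum-sucˡ a n)) (+-assoc _ _ _)

  sum-cong : ∀ {a b} → (∀ i → a i ≈ b i) → ∀ n → sum a n ≈ sum b n
  sum-cong p zero    = refl
  sum-cong p (suc n) = +-cong (sum-cong p n) (p n)

  conv-const : ∀ a x n → conv a (λ _ → x) n ≈ sum a (suc n) * x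
  conv-const a x zero    = *-congʳ (sym (+-identityˡ (a 0)))
  conv-const a x (suc n) = begin
    a 0 * x + conv (a ∘ suc) (λ _ → x) n ≈⟨ +-congˡ (conv-const (a ∘ suc) x n) ⟩
    a 0 * x + sum (a ∘ suc) (suc n) * x  ≈⟨ distribʳ x (a 0) (sum (a ∘ suc) (suc n)) ⟨
    (a 0 + sum (a ∘ suc) (suc n)) * x    ≈⟨ *-congʳ (sum-sucˡ a (suc n)) ⟨
    sum a (suc (suc n)) * x              ∎

  conv-sum : ∀ a b n → conv a (sum b ∘ suc) n ≈ sum (conv a b) (suc n)
  conv-sum a b zero    = trans (*-congˡ (+-identityˡ (b 0))) (sym (+-identityˡ _))
  conv-sum a b (suc n) = begin
    conv a (λ i → sum b i + b i) (suc n)                                ≈⟨ conv-+ʳ a (sum b) b (suc n) ⟩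
    conv a (sum b) (suc n) + conv a b (suc n)                           ≈⟨ +-congʳ (conv-sucʳ a (sum b) n) ⟩
    conv a (sum b ∘ suc) n + a (suc n) * 0# + conv a b (suc n)          ≈⟨ +-congʳ (+-congˡ (zeroʳ (a (suc n)))) ⟩
    conv a (sum b ∘ suc) n + 0# + conv a b (suc n)                      ≈⟨ +-congʳ (+-identityʳ _) ⟩
    conv a (sum b ∘ suc) n + conv a b (suc n)                           ≈⟨ +-congʳ (conv-sum a b n) ⟩
    sum (conv a b) (suc n) + conv a b (suc n)                           ∎

  -- Each a i is paired with the tail of b after index n - i, so the left side collects the products
  -- a i b j with i , j ≤ n < i + j: the excess of the square of index pairs over the triangle.
  sum-*-sum : ∀ a b n → let s = sum b (suc n) in
              conv a (λ i → s - sum b (suc i)) n ≈ sum a (suc n) * s - sum (conv a b) (suc n)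
  sum-*-sum a b n = let s = sum b (suc n) in begin
    conv a (λ i → s - sum b (suc i)) n                        ≈⟨ conv-+ʳ a (λ _ → s) (λ i → - sum b (suc i)) n ⟩
    conv a (λ _ → s) n + conv a (λ i → - sum b (suc i)) n     ≈⟨ +-cong (conv-const a s n) (conv-negʳ a (sum b ∘ suc) n) ⟩
    sum a (suc n) * s - conv a (sum b ∘ suc) n                ≈⟨ +-congˡ (-‿cong (conv-sum a b n)) ⟩
    sum a (suc n) * s - sum (conv a b) (suc n)                ∎

  module Exponential (κ r : ℕ → Carrier) (κ-zero : κ 0 ≈ 0#) (κ-suc : ∀ n → κ (suc n) ≈ 1# + κ n)
                     (r-inverse : ∀ n → r n * κ (suc n) ≈ 1#) where

    weighted : (ℕ → Carrier) → ℕ → Carrier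
    weighted a i = κ i * a i

    -- `κ n` is the numeral n, and the two indices in each product of a convolution add up to n.
    -- Weighting is thus the derivation x d/dx on generating series.
    leibniz : ∀ a b n → conv (weighted a) b n + conv a (weighted b) n ≈ κ n * conv a b n
    leibniz a b zero = begin
      κ 0 * a 0 * b 0 + a 0 * (κ 0 * b 0) ≈⟨ solve 3 (λ k x y → k :* x :* y :+ x :* (k :* y) := k :* (x :* y) :+ k :* (x :* y)) refl (κ 0) (a 0) (b 0) ⟩
      κ 0 * (a 0 * b 0) + κ 0 * (a 0 * b 0) ≈⟨ +-congʳ (trans (*-congʳ κ-zero) (zeroˡ _)) ⟩
      0# + κ 0 * (a 0 * b 0)                ≈⟨ +-identityˡ _ ⟩
      κ 0 * (a 0 * b 0)                     ∎
    leibniz a b (suc n) = begin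
      κ 0 * a 0 * b (suc n) + conv (weighted a ∘ suc) b n + (a 0 * (κ (suc n) * b (suc n)) + conv (a ∘ suc) (weighted b) n)
        ≈⟨ +-congʳ (+-cong (trans (*-congʳ (trans (*-congʳ κ-zero) (zeroˡ _))) (zeroˡ _))
             (trans (conv-cong shift (λ _ → refl) n) (conv-+ˡ (a ∘ suc) (weighted (a ∘ suc)) b n))) ⟩
      0# + (C + conv (weighted (a ∘ suc)) b n) + (a 0 * (κ (suc n) * b (suc n)) + conv (a ∘ suc) (weighted b) n)
        ≈⟨ +-congʳ (+-identityˡ _) ⟩
      C + conv (weighted (a ∘ suc)) b n + (a 0 * (κ (suc n) * b (suc n)) + conv (a ∘ suc) (weighted b) n)
        ≈⟨ solve 6 (λ u v x k y w → u :+ v :+ (x :* (k :* y) :+ w) := k :* (x :* y) :+ (u :+ (v :+ w))) refl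
             C (conv (weighted (a ∘ suc)) b n) (a 0) (κ (suc n)) (b (suc n)) (conv (a ∘ suc) (weighted b) n) ⟩
      κ (suc n) * (a 0 * b (suc n)) + (C + (conv (weighted (a ∘ suc)) b n + conv (a ∘ suc) (weighted b) n))
        ≈⟨ +-congˡ (+-cong (sym (*-identityˡ C)) (leibniz (a ∘ suc) b n)) ⟩
      κ (suc n) * (a 0 * b (suc n)) + (1# * C + κ n * C)
        ≈⟨ +-congˡ (trans (sym (distribʳ C 1# (κ n))) (*-congʳ (sym (κ-suc n)))) ⟩
      κ (suc n) * (a 0 * b (suc n)) + κ (suc n) * C
        ≈⟨ distribˡ (κ (suc n)) _ _ ⟨
      κ (suc n) * (a 0 * b (suc n) + C) ∎
      where
      C = conv (a ∘ suc) b n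
      shift : ∀ i → weighted a (suc i) ≈ a (suc i) + weighted (a ∘ suc) i
      shift i = trans (*-congʳ (κ-suc i)) (trans (distribʳ _ _ _) (+-congʳ (*-identityˡ _)))

    IsExponential : Carrier → (ℕ → Carrier) → Set ℓ
    IsExponential z a = a 0 ≈ 1# × (∀ n → a (suc n) ≈ a n * z * r n)

    weighted-suc : ∀ {z a} → IsExponential z a → ∀ n → weighted a (suc n) ≈ z * a n
    weighted-suc {z} {a} (_ , step) n = begin
      κ (suc n) * a (suc n)       ≈⟨ *-congˡ (step n) ⟩
      κ (suc n) * (a n * z * r n) ≈⟨ solve 4 (λ k x z r → k :* (x :* z :* r) := r :* k :* (z :* x)) refl (κ (suc n)) (a n) z (r n) ⟩
      r n * κ (suc n) * (z * a n) ≈⟨ *-congʳ (r-inverse n) ⟩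
      1# * (z * a n)              ≈⟨ *-identityˡ _ ⟩
      z * a n                     ∎

    -- Weighting the terms by their index turns the Leibniz rule into the recursion of the series of z + w.
    conv-exponential : ∀ {z w a b c} → IsExponential z a → IsExponential w b → IsExponential (z + w) c →
                       ∀ n → conv a b n ≈ c n
    conv-exponential (a₀ , _) (b₀ , _) (c₀ , _) zero = trans (*-cong a₀ b₀) (trans (*-identityˡ 1#) (sym c₀))
    conv-exponential {z} {w} {a} {b} {c} p q s@(_ , c-suc) (suc n) = begin
      conv a b (suc n)                             ≈⟨ *-identityˡ _ ⟨
      1# * conv a b (suc n)                        ≈⟨ *-congʳ (r-inverse n) ⟨
      r n * κ (suc n) * conv a b (suc n)           ≈⟨ *-assoc _ _ _ ⟩
      r n * (κ (suc n) * conv a b (suc n))         ≈⟨ *-congˡ (leibniz a b (suc n)) ⟨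
      r n * (conv (weighted a) b (suc n) + conv a (weighted b) (suc n)) ≈⟨ *-congˡ (+-cong left right) ⟩
      r n * (z * conv a b n + w * conv a b n)      ≈⟨ solve 4 (λ r z w x → r :* (z :* x :+ w :* x) := x :* (z :+ w) :* r) refl (r n) z w (conv a b n) ⟩
      conv a b n * (z + w) * r n                   ≈⟨ *-congʳ (*-congʳ (conv-exponential p q s n)) ⟩
      c n * (z + w) * r n                          ≈⟨ c-suc n ⟨
      c (suc n)                                    ∎
      where
      left : conv (weighted a) b (suc n) ≈ z * conv a b n
      left = begin
        κ 0 * a 0 * b (suc n) + conv (weighted a ∘ suc) b n
          ≈⟨ +-cong (trans (*-congʳ (trans (*-congʳ κ-zero) (zeroˡ _))) (zeroˡ _)) (conv-cong (weighted-suc {z} {a} p) (λ _ → refl) n) ⟩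
        0# + conv (λ i → z * a i) b n ≈⟨ +-identityˡ _ ⟩
        conv (λ i → z * a i) b n      ≈⟨ conv-*ˡ z a b n ⟩
        z * conv a b n                ∎
      right : conv a (weighted b) (suc n) ≈ w * conv a b n
      right = begin
        conv a (weighted b) (suc n)                                  ≈⟨ conv-sucʳ a (weighted b) n ⟩
        conv a (weighted b ∘ suc) n + a (suc n) * (κ 0 * b 0)
          ≈⟨ +-cong (conv-cong (λ _ → refl) (weighted-suc {w} {b} q) n) (trans (*-congˡ (trans (*-congʳ κ-zero) (zeroˡ _))) (zeroʳ _)) ⟩
        conv a (λ i → w * b i) n + 0# ≈⟨ +-identityʳ _ ⟩
        conv a (λ i → w * b i) n      ≈⟨ conv-*ʳ w a b n ⟩
        w * conv a b n                ∎

-- The ring ℚ(i)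

module GaussianRationals where
  open import Data.Rational
  open import Data.Rational.Properties
  open import Relation.Binary.PropositionalEquality
  open +-*-Solver

  infixl 6 _⊕_ _⊖_

  0ᵍ 1ᵍ : ℚ × ℚ
  0ᵍ = 0ℚ , 0ℚ
  1ᵍ = 1ℚ , 0ℚ

  negᵍ : ℚ × ℚ → ℚ × ℚ
  negᵍ (a , b) = - a , - b

  _⊕_ _⊖_ : ℚ × ℚ → ℚ × ℚ → ℚ × ℚ
  z ⊕ w = proj₁ z + proj₁ w , proj₂ z + proj₂ w
  z ⊖ w = z ⊕ negᵍ w

  -- The operations of ℂ act index by index on such pairs, so its ring laws follow from these. The
  -- ring also supplies the coefficients of the ring solver.
  gaussianRationals : CommutativeRing 0ℓ 0ℓ
  gaussianRationals = record
    { Carrier = ℚ × ℚ ; _≈_ = _≡_ ; _+_ = _⊕_ ; _*_ = _·_ ; -_ = negᵍ ; 0# = 0ᵍ ; 1# = 1ᵍ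
    ; isCommutativeRing = record
      { isRing = record
        { +-isAbelianGroup = record
          { isGroup = record
            { isMonoid = record
              { isSemigroup = record
                { isMagma = record { isEquivalence = isEquivalence ; ∙-cong = cong₂ _⊕_ }
                ; assoc = λ (a , b) (c , d) (e , f) → cong₂ _,_ (+-assoc a c e) (+-assoc b d f) }
              ; identity = (λ (a , b) → cong₂ _,_ (+-identityˡ a) (+-identityˡ b)) , (λ (a , b) → cong₂ _,_ (+-identityʳ a) (+-identityʳ b)) }
            ; inverse = (λ (a , b) → cong₂ _,_ (+-inverseˡ a) (+-inverseˡ b)) , (λ (a , b) → cong₂ _,_ (+-inverseʳ a) (+-inverseʳ b))
            ; ⁻¹-cong = cong negᵍ }
          ; comm = λ (a , b) (c , d) → cong₂ _,_ (+-comm a c) (+-comm b d) }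
        ; *-cong = cong₂ _·_
        ; *-assoc = λ (a , b) (c , d) (e , f) → cong₂ _,_
            (solve 6 (λ a b c d e f → (a :* c :- b :* d) :* e :- (a :* d :+ b :* c) :* f := a :* (c :* e :- d :* f) :- b :* (c :* f :+ d :* e)) refl a b c d e f)
            (solve 6 (λ a b c d e f → (a :* c :- b :* d) :* f :+ (a :* d :+ b :* c) :* e := a :* (c :* f :+ d :* e) :+ b :* (c :* e :- d :* f)) refl a b c d e f)
        ; *-identity =
            (λ (a , b) → cong₂ _,_ (solve 2 (λ a b → con 1ℚ :* a :- con 0ℚ :* b := a) refl a b) (solve 2 (λ a b → con 1ℚ :* b :+ con 0ℚ :* a := b) refl a b)) ,
            (λ (a , b) → cong₂ _,_ (solve 2 (λ a b → a :* con 1ℚ :- b :* con 0ℚ := a) refl a b) (solve 2 (λ a b → a :* con 0ℚ :+ b :* con 1ℚ := b) refl a b))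
        ; distrib =
            (λ (a , b) (c , d) (e , f) → cong₂ _,_
              (solve 6 (λ a b c d e f → a :* (c :+ e) :- b :* (d :+ f) := a :* c :- b :* d :+ (a :* e :- b :* f)) refl a b c d e f)
              (solve 6 (λ a b c d e f → a :* (d :+ f) :+ b :* (c :+ e) := a :* d :+ b :* c :+ (a :* f :+ b :* e)) refl a b c d e f)) ,
            (λ (a , b) (c , d) (e , f) → cong₂ _,_
              (solve 6 (λ a b c d e f → (c :+ e) :* a :- (d :+ f) :* b := c :* a :- d :* b :+ (e :* a :- f :* b)) refl a b c d e f)
              (solve 6 (λ a b c d e f → (c :+ e) :* b :+ (d :+ f) :* a := c :* b :+ d :* a :+ (e :* b :+ f :* a)) refl a b c d e f)) }
      ; *-comm = λ (a , b) (c , d) → cong₂ _,_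
          (solve 4 (λ a b c d → a :* c :- b :* d := c :* a :- d :* b) refl a b c d)
          (solve 4 (λ a b c d → a :* d :+ b :* c := c :* b :+ d :* a) refl a b c d) } }

open GaussianRationals

-- The equality of ℂ unfolds, which defeats the inference of implicit arguments; over an abstract ring it does not.
module RingWithExponential {c ℓ} (R : CommutativeRing c ℓ)
  (constants : CommutativeRing.rawRing gaussianRationals -Raw-AlmostCommutative⟶ fromCommutativeRing R) where
  open CommutativeRing R
  open _-Raw-AlmostCommutative⟶_ constants using (⟦_⟧)
  open import Relation.Binary.Reasoning.Setoid setoid
  open RingSolver (CommutativeRing.rawRing gaussianRationals) (fromCommutativeRing R) constants
    (λ z w → map (λ z≡w → reflexive (cong ⟦_⟧ z≡w)) (dec⇒weaklyDec (≡-dec ℚ._≟_ ℚ._≟_) z w))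
    using (solve; con; _:=_; _:+_; _:*_; _:-_; :-_)

  -- Images of Gaussian rationals rather than `1#` and `1# + 1#`, because this is what `con` denotes
  -- in the solver.
  one two : Carrier
  one = ⟦ 1ᵍ ⟧
  two = ⟦ 2ℚ , ℚ.0ℚ ⟧

  -- Consequences of the functional equation over an abstract ring

  module ExponentialLaws (exp : Carrier → Carrier) (exp-cong : ∀ z w → z ≈ w → exp z ≈ exp w)
    (exp-+ : ∀ z w → exp (z + w) ≈ exp z * exp w) (exp-0 : exp ⟦ 0ᵍ ⟧ ≈ one) where

    exp-inverse : ∀ z → exp z * exp (- z) ≈ one
    exp-inverse z = begin
      exp z * exp (- z) ≈⟨ exp-+ z (- z) ⟨
      exp (z + - z)     ≈⟨ exp-cong _ _ (solve 1 (λ z → z :+ (:- z) := con 0ᵍ) refl z) ⟩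
      exp ⟦ 0ᵍ ⟧        ≈⟨ exp-0 ⟩
      one               ∎

    -- For w = i π / 2 the value `s` is i or - i. Trading one factor of its square for `- exp (- w)`
    -- leads to `exp-inverse`, so the choice between the two never has to be made.
    exp-double : ∀ {w s} → exp w ≈ s → exp (- w) ≈ - s → exp (w + w) ≈ - one
    exp-double {w} {s} p q = begin
      exp (w + w)             ≈⟨ exp-+ w w ⟩
      exp w * exp w           ≈⟨ *-cong p p ⟩
      s * s                   ≈⟨ solve 1 (λ s → s :* s := :- (s :* (:- s))) refl s ⟩
      - (s * - s)             ≈⟨ -‿cong (*-cong p q) ⟨
      - (exp w * exp (- w))   ≈⟨ -‿cong (exp-inverse w) ⟩
      - one                   ∎

    -- The recurrences of Θ and Ω

    -- Here `a` is i π, `l` is log φ and `s` is 1 / √5; `e n`, `X n` and `Y n` are (-1)^n, φ^n and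
    -- (-φ)^(-n).
    module Fibonacci (a l φ s : Carrier) (exp-a : exp a ≈ - one) (exp-l : exp l ≈ φ) (φ-square : φ * φ ≈ φ + one)
      (e X Y Θ : Carrier → Carrier)
      (e≡ : ∀ n → e n ≡ exp (a * n))
      (X≡ : ∀ n → X n ≡ exp (n * l))
      (Y≡ : ∀ n → Y n ≡ e (- n) * X (- n))
      (Θ≡ : ∀ n → Θ n ≡ (X n - Y n) * s)
      where

      -- This is 1 / φ, not the conjugate root - 1 / φ.
      ψ : Carrier
      ψ = exp (- l)

      e≈ : ∀ n → e n ≈ exp (a * n)
      e≈ n = reflexive (e≡ n)

      X≈ : ∀ n → X n ≈ exp (n * l)
      X≈ n = reflexive (X≡ n)

      Y≈ : ∀ n → Y n ≈ e (- n) * X (- n)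
      Y≈ n = reflexive (Y≡ n)

      Θ≈ : ∀ n → Θ n ≈ (X n - Y n) * s
      Θ≈ n = reflexive (Θ≡ n)

      e-cong : ∀ {n m} → n ≈ m → e n ≈ e m
      e-cong {n} {m} p = trans (e≈ n) (trans (exp-cong _ _ (*-congˡ p)) (sym (e≈ m)))

      X-cong : ∀ {n m} → n ≈ m → X n ≈ X m
      X-cong {n} {m} p = trans (X≈ n) (trans (exp-cong _ _ (*-congʳ p)) (sym (X≈ m)))

      Y-cong : ∀ {n m} → n ≈ m → Y n ≈ Y m
      Y-cong {n} {m} p = trans (Y≈ n) (trans (*-cong (e-cong (-‿cong p)) (X-cong (-‿cong p))) (sym (Y≈ m)))

      Θ-cong : ∀ {n m} → n ≈ m → Θ n ≈ Θ m
      Θ-cong {n} {m} p = trans (Θ≈ n) (trans (*-congʳ (+-cong (X-cong p) (-‿cong (Y-cong p)))) (sym (Θ≈ m)))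

      e-suc : ∀ n → e (n + one) ≈ - e n
      e-suc n = begin
        e (n + one)         ≈⟨ e≈ (n + one) ⟩
        exp (a * (n + one)) ≈⟨ exp-cong _ _ (solve 2 (λ a n → a :* (n :+ con 1ᵍ) := a :* n :+ a) refl a n) ⟩
        exp (a * n + a)     ≈⟨ exp-+ (a * n) a ⟩
        exp (a * n) * exp a ≈⟨ *-cong (sym (e≈ n)) exp-a ⟩
        e n * - one         ≈⟨ solve 1 (λ x → x :* (:- con 1ᵍ) := :- x) refl (e n) ⟩
        - e n               ∎

      e-pred : ∀ n → e (n - one) ≈ - e n
      e-pred n = begin
        e (n - one)           ≈⟨ solve 1 (λ x → x := :- (:- x)) refl (e (n - one)) ⟩
        - - e (n - one)       ≈⟨ -‿cong (e-suc (n - one)) ⟨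
        - e (n - one + one)   ≈⟨ -‿cong (e-cong (solve 1 (λ n → n :- con 1ᵍ :+ con 1ᵍ := n) refl n)) ⟩
        - e n                 ∎

      X-suc : ∀ n → X (n + one) ≈ X n * φ
      X-suc n = begin
        X (n + one)         ≈⟨ X≈ (n + one) ⟩
        exp ((n + one) * l) ≈⟨ exp-cong _ _ (solve 2 (λ l n → (n :+ con 1ᵍ) :* l := n :* l :+ l) refl l n) ⟩
        exp (n * l + l)     ≈⟨ exp-+ (n * l) l ⟩
        exp (n * l) * exp l ≈⟨ *-cong (sym (X≈ n)) exp-l ⟩
        X n * φ             ∎

      X-pred : ∀ n → X (n - one) ≈ X n * ψ
      X-pred n = begin
        X (n - one)           ≈⟨ X≈ (n - one) ⟩
        exp ((n - one) * l)   ≈⟨ exp-cong _ _ (solve 2 (λ l n → (n :- con 1ᵍ) :* l := n :* l :+ (:- l)) refl l n) ⟩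
        exp (n * l + - l)     ≈⟨ exp-+ (n * l) (- l) ⟩
        exp (n * l) * ψ       ≈⟨ *-congʳ (X≈ n) ⟨
        X n * ψ               ∎

      Y-pred : ∀ n → Y (n - one) ≈ - (Y n * φ)
      Y-pred n = begin
        Y (n - one)                         ≈⟨ Y≈ (n - one) ⟩
        e (- (n - one)) * X (- (n - one))   ≈⟨ *-cong (e-cong flip) (X-cong flip) ⟩
        e (- n + one) * X (- n + one)       ≈⟨ *-cong (e-suc (- n)) (X-suc (- n)) ⟩
        - e (- n) * (X (- n) * φ)           ≈⟨ solve 3 (λ x y z → :- x :* (y :* z) := :- (x :* y :* z)) refl (e (- n)) (X (- n)) φ ⟩
        - (e (- n) * X (- n) * φ)           ≈⟨ -‿cong (*-congʳ (Y≈ n)) ⟨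
        - (Y n * φ)                         ∎
        where
        flip : - (n - one) ≈ - n + one
        flip = solve 1 (λ n → :- (n :- con 1ᵍ) := :- n :+ con 1ᵍ) refl n

      φ*ψ : φ * ψ ≈ one
      φ*ψ = trans (*-congʳ (sym exp-l)) (exp-inverse l)

      ψ-square : ψ * ψ + ψ ≈ one
      ψ-square = begin
        ψ * ψ + ψ                 ≈⟨ solve 1 (λ ψ → ψ :* ψ :+ ψ := ψ :* ψ :+ con 1ᵍ :* ψ) refl ψ ⟩
        ψ * ψ + one * ψ           ≈⟨ +-congˡ (*-congʳ φ*ψ) ⟨
        ψ * ψ + φ * ψ * ψ         ≈⟨ solve 2 (λ φ ψ → ψ :* ψ :+ φ :* ψ :* ψ := (φ :+ con 1ᵍ) :* (ψ :* ψ)) refl φ ψ ⟩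
        (φ + one) * (ψ * ψ)       ≈⟨ *-congʳ φ-square ⟨
        φ * φ * (ψ * ψ)           ≈⟨ solve 2 (λ φ ψ → φ :* φ :* (ψ :* ψ) := φ :* ψ :* (φ :* ψ)) refl φ ψ ⟩
        φ * ψ * (φ * ψ)           ≈⟨ *-cong φ*ψ φ*ψ ⟩
        one * one                 ≈⟨ solve 0 (con 1ᵍ :* con 1ᵍ := con 1ᵍ) refl ⟩
        one                       ∎

      -- A step back multiplies `X` by `ψ` and `Y` by `- φ`, and both factors satisfy t² + t = 1.
      -- Hence `X` and `Y` obey the recurrence separately.
      Θ-recurrence : ∀ n → Θ n ≈ Θ (n - one) + Θ (n - one - one)
      Θ-recurrence n = sym (begin
        Θ m + Θ (m - one)
          ≈⟨ +-cong (Θ≈ m) (Θ≈ (m - one)) ⟩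
        (X m - Y m) * s + (X (m - one) - Y (m - one)) * s
          ≈⟨ +-cong (*-congʳ (+-cong (X-pred n) (-‿cong (Y-pred n))))
               (*-congʳ (+-cong (trans (X-pred m) (*-congʳ (X-pred n))) (-‿cong (trans (Y-pred m) (-‿cong (*-congʳ (Y-pred n))))))) ⟩
        (X n * ψ - - (Y n * φ)) * s + (X n * ψ * ψ - - (- (Y n * φ) * φ)) * s
          ≈⟨ solve 5 (λ x y φ ψ s → (x :* ψ :- (:- (y :* φ))) :* s :+ (x :* ψ :* ψ :- (:- (:- (y :* φ) :* φ))) :* s :=
               (x :* (ψ :* ψ :+ ψ) :+ y :* (φ :- φ :* φ)) :* s) refl (X n) (Y n) φ ψ s ⟩
        (X n * (ψ * ψ + ψ) + Y n * (φ - φ * φ)) * s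
          ≈⟨ *-congʳ (+-cong (*-congˡ ψ-square) (*-congˡ (+-congˡ (-‿cong φ-square)))) ⟩
        (X n * one + Y n * (φ - (φ + one))) * s
          ≈⟨ solve 4 (λ x y φ s → (x :* con 1ᵍ :+ y :* (φ :- (φ :+ con 1ᵍ))) :* s := (x :- y) :* s) refl (X n) (Y n) φ s ⟩
        (X n - Y n) * s
          ≈⟨ Θ≈ n ⟨
        Θ n ∎)
        where m = n - one

      module Combination (η γ : Carrier) (Ω : Carrier → Carrier)
        (Ω≡ : ∀ n → Ω n ≡ η * e (n - one) * Θ n + γ * e n * Θ (n - one) * φ) where

        Ω≈ : ∀ n → Ω n ≈ η * e (n - one) * Θ n + γ * e n * Θ (n - one) * φ
        Ω≈ n = reflexive (Ω≡ n)

        Ω-cong : ∀ {n m} → n ≈ m → Ω n ≈ Ω m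
        Ω-cong {n} {m} p = trans (Ω≈ n) (trans
          (+-cong (*-cong (*-congˡ (e-cong (+-congʳ p))) (Θ-cong p))
            (*-congʳ (*-cong (*-congˡ (e-cong p)) (Θ-cong (+-congʳ p)))))
          (sym (Ω≈ m)))

        Ω-recurrence : ∀ n → Ω n ≈ Ω (n - two) - Ω (n - one)
        Ω-recurrence n = begin
          Ω n
            ≈⟨ Ω≈ n ⟩
          η * e m * Θ n + γ * e n * Θ m * φ
            ≈⟨ +-cong (*-cong (*-congˡ (e-pred n)) (Θ-recurrence n)) (*-congʳ (*-congˡ (Θ-recurrence m))) ⟩
          η * - e n * (Θ m + Θ k) + γ * e n * (Θ k + Θ (k - one)) * φ
            -- The repeated negations are left standing on purpose: each sign is one shift of `e`,
            -- and the next step folds one, two and three of them into `e m`, `e k` and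
            -- `e (k - one)`.
            ≈⟨ solve 7 (λ η γ e x y z φ → η :* (:- e) :* (x :+ y) :+ γ :* e :* (y :+ z) :* φ :=
                 η :* (:- (:- (:- e))) :* y :+ γ :* (:- (:- e)) :* z :* φ :- (η :* (:- (:- e)) :* x :+ γ :* (:- e) :* y :* φ))
                 refl η γ (e n) (Θ m) (Θ k) (Θ (k - one)) φ ⟩
          η * - - - e n * Θ k + γ * - - e n * Θ (k - one) * φ - (η * - - e n * Θ m + γ * - e n * Θ k * φ)
            ≈⟨ +-cong (+-cong (*-congʳ (*-congˡ (trans (e-pred k) (-‿cong e-k)))) (*-congʳ (*-congʳ (*-congˡ e-k))))
                 (-‿cong (+-cong (*-congʳ (*-congˡ e-k)) (*-congʳ (*-congʳ (*-congˡ (e-pred n)))))) ⟨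
          η * e (k - one) * Θ k + γ * e k * Θ (k - one) * φ - (η * e k * Θ m + γ * e m * Θ k * φ)
            ≈⟨ +-cong (Ω≈ k) (-‿cong (Ω≈ m)) ⟨
          Ω k - Ω m
            ≈⟨ +-congʳ (Ω-cong (solve 1 (λ n → n :- con 1ᵍ :- con 1ᵍ := n :- con (2ℚ , ℚ.0ℚ)) refl n)) ⟩
          Ω (n - two) - Ω m ∎
          where
          m = n - one
          k = m - one
          e-k : e k ≈ - - e n
          e-k = trans (e-pred m) (-‿cong (e-pred n))

-- Partial sums of the exponential series and their products

open import Data.Rational
open import Data.Rational.Properties
open import Relation.Binary.PropositionalEquality
open +-*-Solver

module Q = CauchyProduct +-*-commutativeRing
module G = CauchyProduct gaussianRationals
module QE = Q.Exponential ι recip refl ι-suc recip-ι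
module GE = G.Exponential (λ n → ι n , 0ℚ) (λ n → recip n , 0ℚ) refl
  (λ n → cong₂ _,_ (ι-suc n) refl)
  (λ n → cong₂ _,_ (trans (solve 2 (λ r i → r :* i :- con 0ℚ :* con 0ℚ := r :* i) refl (recip n) (ι (suc n))) (recip-ι n))
                   (solve 2 (λ r i → r :* con 0ℚ :+ con 0ℚ :* i := con 0ℚ) refl (recip n) (ι (suc n))))

absSum : ℕ → ℚ → ℚ
absSum n B = Q.sum (λ k → absTerm k B) n

expSum≡sum : ∀ n z → expSum n z ≡ G.sum (λ k → expTerm k z) n
expSum≡sum zero    z = refl
expSum≡sum (suc n) z = cong (_⊕ expTerm n z) (expSum≡sum n z)

absTerm-exponential : ∀ B → QE.IsExponential B (λ k → absTerm k B)
absTerm-exponential B = refl , λ _ → refl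

expTerm-exponential : ∀ z → GE.IsExponential z (λ k → expTerm k z)
expTerm-exponential z = refl , λ n → let (a , b) = expTerm n z · z in cong₂ _,_
  (solve 3 (λ a b r → a :* r := a :* r :- b :* con 0ℚ) refl a b (recip n))
  (solve 3 (λ a b r → b :* r := a :* con 0ℚ :+ b :* r) refl a b (recip n))

∥⊕∥ : ∀ z w → ∥ z ⊕ w ∥ ≤ ∥ z ∥ + ∥ w ∥
∥⊕∥ (a , b) (c , d) = subst (∥ (a , b) ⊕ (c , d) ∥ ≤_)
  (solve 4 (λ a b c d → a :+ c :+ (b :+ d) := a :+ b :+ (c :+ d)) refl (∣ a ∣) (∣ b ∣) (∣ c ∣) (∣ d ∣))
  (+-mono-≤ (∣p+q∣≤∣p∣+∣q∣ a c) (∣p+q∣≤∣p∣+∣q∣ b d))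

real-· : ∀ p q → (p , 0ℚ) · (q , 0ℚ) ≡ (p * q , 0ℚ)
real-· p q = cong₂ _,_
  (solve 2 (λ p q → p :* q :- con 0ℚ :* con 0ℚ := p :* q) refl p q)
  (solve 2 (λ p q → p :* con 0ℚ :+ con 0ℚ :* q := con 0ℚ) refl p q)

expTerm-real : ∀ k q → expTerm k (q , 0ℚ) ≡ (absTerm k q , 0ℚ)
expTerm-real zero    q = refl
expTerm-real (suc k) q = trans
  (cong (λ t → proj₁ t * recip k , proj₂ t * recip k) (trans (cong (_· (q , 0ℚ)) (expTerm-real k q)) (real-· (absTerm k q) q)))
  (cong (absTerm k q * q * recip k ,_) (*-zeroˡ (recip k)))

expSum-real : ∀ n q → expSum n (q , 0ℚ) ≡ (absSum n q , 0ℚ)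
expSum-real zero    q = refl
expSum-real (suc n) q = cong₂ _⊕_ (expSum-real n q) (expTerm-real n q)

-- The series is that of `exp` at the constant sequence `B`, so convergence is inherited from
-- `exp-cauchy`.
absSum-cauchy : ∀ B → Cauchy (λ n → absSum n B)
absSum-cauchy B ε 0<ε =
  let N , near = proj₁ (exp-cauchy (λ _ → B , 0ℚ) (const-cauchy B , const-cauchy 0ℚ)) ε 0<ε
  in N , λ m n p q → subst₂ (λ x y → ∣ x - y ∣ ≤ ε) (cong proj₁ (expSum-real m B)) (cong proj₁ (expSum-real n B)) (near m n p q)

sum-nonneg : ∀ {α} → (∀ i → 0ℚ ≤ α i) → ∀ n → 0ℚ ≤ Q.sum α n
sum-nonneg p zero    = ≤-refl
sum-nonneg p (suc n) = add0 (sum-nonneg p n) (p n)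

sum-mono : ∀ {α} → (∀ i → 0ℚ ≤ α i) → ∀ {m n} → m ℕ.≤ n → Q.sum α m ≤ Q.sum α n
sum-mono p {n = zero} ℕ.z≤n = ≤-refl
sum-mono {α} p {m} {suc n} m≤ with ℕP.m≤n⇒m<n∨m≡n m≤
... | inj₁ (ℕ.s≤s m≤n) = ≤-trans (sum-mono p m≤n) (le (α n) (p n) refl)
... | inj₂ refl = ≤-refl

conv-nonneg : ∀ {α β} → (∀ i → 0ℚ ≤ α i) → (∀ i → 0ℚ ≤ β i) → ∀ n → 0ℚ ≤ Q.conv α β n
conv-nonneg p q zero    = mul0 (p 0) (q 0)
conv-nonneg p q (suc n) = add0 (mul0 (p 0) (q (suc n))) (conv-nonneg (p ∘ suc) q n)

-- The bound on `b` is asked for only up to n, because `b` will be a sequence of tails that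
-- `sum-diff` controls only that far.
∥conv∥ : ∀ {a b α β} n → (∀ i → ∥ a i ∥ ≤ α i) → (∀ i → i ℕ.≤ n → ∥ b i ∥ ≤ β i) → ∥ G.conv a b n ∥ ≤ Q.conv α β n
∥conv∥ {a} {b} zero p q = ≤-trans (∥·∥ (a 0) (b 0)) (mul-mono (0≤∥∥ (a 0)) (p 0) (0≤∥∥ (b 0)) (q 0 ℕ.z≤n))
∥conv∥ {a} {b} (suc n) p q = ≤-trans (∥⊕∥ (a 0 · b (suc n)) (G.conv (a ∘ suc) b n)) (+-mono-≤
  (≤-trans (∥·∥ (a 0) (b (suc n))) (mul-mono (0≤∥∥ (a 0)) (p 0) (0≤∥∥ (b (suc n))) (q (suc n) ℕP.≤-refl)))
  (∥conv∥ n (p ∘ suc) (λ i i≤n → q i (ℕP.m≤n⇒m≤1+n i≤n))))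

-- For i ≤ n the factor `x` meets β at index n + m - i ≥ m; the terms with larger i are nonnegative.
-- With m = n and β the partial sums of a series, this places the square of index pairs i , j ≤ n
-- inside the triangle i + j ≤ 2n.
conv-const-≤ : ∀ {α β x} m n → (∀ i → 0ℚ ≤ α i) → 0ℚ ≤ x → (∀ i → 0ℚ ≤ β i) → (∀ i → m ℕ.≤ i → x ≤ β i) →
               Q.conv α (λ _ → x) n ≤ Q.conv α β (n ℕ.+ m)
conv-const-≤ zero zero p 0≤x 0≤β q = mul-mono (p 0) ≤-refl 0≤x (q 0 ℕ.z≤n)
conv-const-≤ {α} {β} {x} (suc m) zero p 0≤x 0≤β q = ≤-trans (mul-mono (p 0) ≤-refl 0≤x (q (suc m) ℕP.≤-refl))
  (le (Q.conv (α ∘ suc) β m) (conv-nonneg (p ∘ suc) 0≤β m) refl)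
conv-const-≤ m (suc n) p 0≤x 0≤β q =
  +-mono-≤ (mul-mono (p 0) ≤-refl 0≤x (q (suc (n ℕ.+ m)) (ℕP.m≤n+m m (suc n)))) (conv-const-≤ m n (p ∘ suc) 0≤x 0≤β q)

sum-diff : ∀ {a α} → (∀ i → ∥ a i ∥ ≤ α i) → ∀ {m n} → m ℕ.≤ n → ∥ G.sum a n ⊖ G.sum a m ∥ ≤ Q.sum α n - Q.sum α m
sum-diff {a} {α} p {m} {n} m≤n = subst (λ k → ∥ G.sum a k ⊖ G.sum a m ∥ ≤ Q.sum α k - Q.sum α m) (ℕP.m∸n+n≡m m≤n) (go (n ℕ.∸ m))
  where
  go : ∀ j → ∥ G.sum a (j ℕ.+ m) ⊖ G.sum a m ∥ ≤ Q.sum α (j ℕ.+ m) - Q.sum α m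
  go zero = ≤-reflexive (trans (cong ∥_∥ (cong₂ _,_ (+-inverseʳ (proj₁ (G.sum a m))) (+-inverseʳ (proj₂ (G.sum a m))))) (sym (+-inverseʳ (Q.sum α m))))
  go (suc j) = let k = j ℕ.+ m in subst₂ _≤_
    (cong ∥_∥ (cong₂ _,_ (swap (proj₁ (G.sum a k)) (proj₁ (G.sum a m)) (proj₁ (a k))) (swap (proj₂ (G.sum a k)) (proj₂ (G.sum a m)) (proj₂ (a k)))))
    (swap (Q.sum α k) (Q.sum α m) (α k))
    (≤-trans (∥⊕∥ (G.sum a k ⊖ G.sum a m) (a k)) (+-mono-≤ (go j) (p k)))
    where
    swap : ∀ x y z → x - y + z ≡ x + z - y
    swap = solve 3 (λ x y z → x :- y :+ z := x :+ z :- y) refl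

-- The omitted products of the terms of index j, k ≤ n with j + k > n occur in the expansion of the real series at A + B.
expSum-+ : ∀ {A B} z w → ∥ z ∥ ≤ A → ∥ w ∥ ≤ B → ∀ n →
           ∥ (expSum (suc n) z · expSum (suc n) w) ⊖ expSum (suc n) (z ⊕ w) ∥ ≤ absSum (suc (n ℕ.+ n)) (A + B) - absSum (suc n) (A + B)
expSum-+ {A} {B} z w z≤A w≤B n = subst₂ _≤_ (cong ∥_∥ defect) refl (≤-trans
    (∥conv∥ {α = u} {β = λ i → s - Q.sum v (suc i)} n (λ i → ∥expTerm∥ i z z≤A) (λ i i≤n → sum-diff (λ j → ∥expTerm∥ j w w≤B) (ℕ.s≤s i≤n)))
    (subst₂ _≤_ (sym (trans (Q.sum-*-sum u v n) (cong₂ _-_ (sym (Q.conv-const u s n)) (Q.sum-cong conv≡ (suc n)))))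
       refl (+-monoˡ-≤ (- absSum (suc n) (A + B)) bound)))
  where
  u v : ℕ → ℚ
  u k = absTerm k A
  v k = absTerm k B
  s : ℚ
  s = Q.sum v (suc n)
  0≤A : 0ℚ ≤ A
  0≤A = ≤-trans (0≤∥∥ z) z≤A
  0≤B : 0ℚ ≤ B
  0≤B = ≤-trans (0≤∥∥ w) w≤B
  0≤u : ∀ i → 0ℚ ≤ u i
  0≤u i = 0≤absTerm i 0≤A
  0≤v : ∀ i → 0ℚ ≤ v i
  0≤v i = 0≤absTerm i 0≤B
  conv≡ : ∀ i → Q.conv u v i ≡ absTerm i (A + B)
  conv≡ = QE.conv-exponential {A} {B} {u} {v} (absTerm-exponential A) (absTerm-exponential B) (absTerm-exponential (A + B))
  bound : Q.conv u (λ _ → s) n ≤ absSum (suc (n ℕ.+ n)) (A + B)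
  bound = ≤-trans (conv-const-≤ n n 0≤u (sum-nonneg 0≤v (suc n)) (λ i → sum-nonneg 0≤v (suc i)) (λ i n≤i → sum-mono 0≤v (ℕ.s≤s n≤i)))
    (≤-reflexive (trans (Q.conv-sum u v (n ℕ.+ n)) (Q.sum-cong conv≡ (suc (n ℕ.+ n)))))
  a b : ℕ → ℚ × ℚ
  a k = expTerm k z
  b k = expTerm k w
  defect : G.conv a (λ i → G.sum b (suc n) ⊖ G.sum b (suc i)) n ≡ (expSum (suc n) z · expSum (suc n) w) ⊖ expSum (suc n) (z ⊕ w)
  defect = trans (G.sum-*-sum a b n) (cong₂ _⊖_
    (sym (cong₂ _·_ (expSum≡sum (suc n) z) (expSum≡sum (suc n) w)))
    (trans (G.sum-cong (GE.conv-exponential {z} {w} {a} {b} (expTerm-exponential z) (expTerm-exponential w) (expTerm-exponential (z ⊕ w))) (suc n))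
      (sym (expSum≡sum (suc n) (z ⊕ w)))))

-- Null sequences and the equality of ℝ

-- Only an upper bound, hence convergence to 0 when the terms are nonnegative. `x ≈ʳ y` unfolds to
-- `Null` of the absolute differences, so domination arguments apply to it directly.
Null : (ℕ → ℚ) → Set
Null x = ∀ ε → 0ℚ < ε → ∃[ N ] ∀ n → N ℕ.≤ n → x n ≤ ε

null-≤ : ∀ {x y} → (∀ n → x n ≤ y n) → Null y → Null x
null-≤ x≤y y→0 ε 0<ε = let N , small = y→0 ε 0<ε in N , λ n N≤n → ≤-trans (x≤y n) (small n N≤n)

null-+ : ∀ {x y} → Null x → Null y → Null (λ n → x n + y n)
null-+ x→0 y→0 ε 0<ε =
  let N , p = x→0 (ε * ½) (half-pos 0<ε)
      M , q = y→0 (ε * ½) (half-pos 0<ε)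
  in N ℕ.⊔ M , λ n le′ → subst (_ ≤_) (halves ε) (+-mono-≤ (p n (ℕP.m⊔n≤o⇒m≤o N M le′)) (q n (ℕP.m⊔n≤o⇒n≤o N M le′)))

null-* : ∀ {x} B → 0ℚ ≤ B → Null x → Null (λ n → B * x n)
null-* B 0≤B x→0 ε 0<ε =
  let δ , 0<δ , Bδ≤ε = shrink B ε 0≤B 0<ε
      N , small = x→0 δ 0<δ
  in N , λ n N≤n → ≤-trans (*-monoˡ-≤-nonNeg B {{nonNegative 0≤B}} (small n N≤n)) Bδ≤ε

-- Discards index 0, where the partial sum of the series is empty and the estimates for
-- `expSum (suc n)` say nothing.
null-suc : ∀ {x} → Null (x ∘ suc) → Null x
null-suc x→0 ε 0<ε = let N , small = x→0 ε 0<ε in suc N , λ { (suc n) (ℕ.s≤s N≤n) → small n N≤n }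

recip-null : Null recip
recip-null ε 0<ε = let N , small = small-recip ε 0<ε in N , λ n N≤n → ≤-trans (recip-anti N≤n) small

0-null : Null (λ _ → 0ℚ)
0-null ε 0<ε = 0 , λ _ _ → <⇒≤ 0<ε

≈ʳ-pointwise : ∀ {x y} → (∀ n → seq x n ≡ seq y n) → x ≈ʳ y
≈ʳ-pointwise {x} {y} eq = null-≤ (λ n → ≤-reflexive (trans (cong (λ t → ∣ t - seq y n ∣) (eq n)) (cong ∣_∣ (+-inverseʳ (seq y n))))) 0-null

≈ʳ-sym : ∀ {x y} → x ≈ʳ y → y ≈ʳ x
≈ʳ-sym {x} {y} = null-≤ (λ n → ≤-reflexive (∣-∣-sym (seq y n) (seq x n)))

≈ʳ-trans : ∀ {x y z} → x ≈ʳ y → y ≈ʳ z → x ≈ʳ z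
≈ʳ-trans {x} {y} {z} p q = null-≤ (λ n → tri (seq x n) (seq y n) (seq z n)) (null-+ p q)

+ʳ-cong : ∀ {x x′ y y′} → x ≈ʳ x′ → y ≈ʳ y′ → x +ʳ y ≈ʳ x′ +ʳ y′
+ʳ-cong {x} {x′} {y} {y′} p q = null-≤ (λ n → subst (_≤ ∣ seq x n - seq x′ n ∣ + ∣ seq y n - seq y′ n ∣)
  (cong ∣_∣ (solve 4 (λ a b c d → (a :- b) :+ (c :- d) := a :+ c :- (b :+ d)) refl (seq x n) (seq x′ n) (seq y n) (seq y′ n)))
  (∣p+q∣≤∣p∣+∣q∣ (seq x n - seq x′ n) (seq y n - seq y′ n))) (null-+ p q)

-ʳ-cong : ∀ {x y} → x ≈ʳ y → -ʳ x ≈ʳ -ʳ y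
-ʳ-cong {x} {y} = null-≤ (λ n → ≤-reflexive (trans
  (cong ∣_∣ (solve 2 (λ a b → :- a :- (:- b) := b :- a) refl (seq x n) (seq y n))) (∣-∣-sym (seq y n) (seq x n))))

*ʳ-cong : ∀ {x x′ y y′} → x ≈ʳ x′ → y ≈ʳ y′ → x *ʳ y ≈ʳ x′ *ʳ y′
*ʳ-cong {x} {x′} {y} {y′} p q =
  let A , 0≤A , x≤A  = bounded (cauchy x)
      B , 0≤B , y′≤B = bounded (cauchy y′)
  in null-≤ {λ n → ∣ seq x n * seq y n - seq x′ n * seq y′ n ∣} {λ n → (A + B) * (∣ seq x n - seq x′ n ∣ + ∣ seq y n - seq y′ n ∣)}
       -- `*-near` takes one bound for both differences; their sum serves.
       (λ n → *-near {seq x n} {seq y n} {seq x′ n} {seq y′ n} {A} {B} (x≤A n) (y′≤B n)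
         (le ∣ seq y n - seq y′ n ∣ (0≤∣p∣ (seq y n - seq y′ n)) refl)
         (le ∣ seq x n - seq x′ n ∣ (0≤∣p∣ (seq x n - seq x′ n)) (+-comm ∣ seq x n - seq x′ n ∣ ∣ seq y n - seq y′ n ∣)))
       (null-* (A + B) (add0 0≤A 0≤B) (null-+ p q))

-- The commutative ring ℂ

at : ℂ → ℕ → ℚ × ℚ
at z n = seq (re z) n , seq (im z) n

≈ᶜ-pointwise : ∀ {z w} → (∀ n → at z n ≡ at w n) → z ≈ᶜ w
≈ᶜ-pointwise {z} {w} eq = ≈ʳ-pointwise {re z} {re w} (λ n → cong proj₁ (eq n)) , ≈ʳ-pointwise {im z} {im w} (λ n → cong proj₂ (eq n))

≈ᶜ-intro : ∀ {z w} → Null (λ n → ∥ at z n ⊖ at w n ∥) → z ≈ᶜ w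
≈ᶜ-intro {z} {w} p = null-≤ (λ n → re≤∥∥ (at z n ⊖ at w n)) p , null-≤ (λ n → im≤∥∥ (at z n ⊖ at w n)) p

∥at∥-bounded : ∀ z → ∃[ B ] 0ℚ ≤ B × (∀ n → ∥ at z n ∥ ≤ B)
∥at∥-bounded z =
  let A , 0≤A , re≤A = bounded {seq (re z)} (cauchy (re z))
      B , 0≤B , im≤B = bounded {seq (im z)} (cauchy (im z))
  in A + B , add0 0≤A 0≤B , λ n → +-mono-≤ (re≤A n) (im≤B n)

complexNumbers : CommutativeRing 0ℓ 0ℓ
complexNumbers = record
  { Carrier = ℂ ; _≈_ = _≈ᶜ_ ; _+_ = _+ᶜ_ ; _*_ = _*ᶜ_ ; -_ = -ᶜ_ ; 0# = fromℝ (fromℚ 0ℚ) ; 1# = 1ᶜ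
  ; isCommutativeRing = record
    { isRing = record
      { +-isAbelianGroup = record
        { isGroup = record
          { isMonoid = record
            { isSemigroup = record
              { isMagma = record
                { isEquivalence = record
                  { refl  = λ {z} → ≈ᶜ-pointwise {z} {z} (λ _ → refl)
                  ; sym   = λ {z} {w} (p , q) → ≈ʳ-sym {re z} {re w} p , ≈ʳ-sym {im z} {im w} q
                  ; trans = λ {z} {w} {v} (p , q) (p′ , q′) → ≈ʳ-trans {re z} {re w} {re v} p p′ , ≈ʳ-trans {im z} {im w} {im v} q q′ }
                ; ∙-cong = λ {z} {z′} {w} {w′} (p , q) (p′ , q′) →
                    +ʳ-cong {re z} {re z′} {re w} {re w′} p p′ , +ʳ-cong {im z} {im z′} {im w} {im w′} q q′ }
              ; assoc = λ z w v → ≈ᶜ-pointwise {(z +ᶜ w) +ᶜ v} {z +ᶜ (w +ᶜ v)} (λ n → R.+-assoc (at z n) (at w n) (at v n)) }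
            ; identity = (λ z → ≈ᶜ-pointwise {fromℝ (fromℚ 0ℚ) +ᶜ z} {z} (λ n → R.+-identityˡ (at z n))) ,
                         (λ z → ≈ᶜ-pointwise {z +ᶜ fromℝ (fromℚ 0ℚ)} {z} (λ n → R.+-identityʳ (at z n))) }
          ; inverse = (λ z → ≈ᶜ-pointwise {(-ᶜ z) +ᶜ z} {fromℝ (fromℚ 0ℚ)} (λ n → R.-‿inverseˡ (at z n))) ,
                      (λ z → ≈ᶜ-pointwise {z +ᶜ (-ᶜ z)} {fromℝ (fromℚ 0ℚ)} (λ n → R.-‿inverseʳ (at z n)))
          ; ⁻¹-cong = λ {z} {w} (p , q) → -ʳ-cong {re z} {re w} p , -ʳ-cong {im z} {im w} q }
        ; comm = λ z w → ≈ᶜ-pointwise {z +ᶜ w} {w +ᶜ z} (λ n → R.+-comm (at z n) (at w n)) }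
      ; *-cong = λ {z} {z′} {w} {w′} (p , q) (p′ , q′) →
          +ʳ-cong {re z *ʳ re w} {re z′ *ʳ re w′} { -ʳ (im z *ʳ im w)} { -ʳ (im z′ *ʳ im w′)}
            (*ʳ-cong {re z} {re z′} {re w} {re w′} p p′) (-ʳ-cong {im z *ʳ im w} {im z′ *ʳ im w′} (*ʳ-cong {im z} {im z′} {im w} {im w′} q q′)) ,
          +ʳ-cong {re z *ʳ im w} {re z′ *ʳ im w′} {im z *ʳ re w} {im z′ *ʳ re w′}
            (*ʳ-cong {re z} {re z′} {im w} {im w′} p q′) (*ʳ-cong {im z} {im z′} {re w} {re w′} q p′)
      ; *-assoc = λ z w v → ≈ᶜ-pointwise {(z *ᶜ w) *ᶜ v} {z *ᶜ (w *ᶜ v)} (λ n → R.*-assoc (at z n) (at w n) (at v n))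
      ; *-identity = (λ z → ≈ᶜ-pointwise {1ᶜ *ᶜ z} {z} (λ n → R.*-identityˡ (at z n))) ,
                     (λ z → ≈ᶜ-pointwise {z *ᶜ 1ᶜ} {z} (λ n → R.*-identityʳ (at z n)))
      ; distrib = (λ z w v → ≈ᶜ-pointwise {z *ᶜ (w +ᶜ v)} {z *ᶜ w +ᶜ z *ᶜ v} (λ n → R.distribˡ (at z n) (at w n) (at v n))) ,
                  (λ z w v → ≈ᶜ-pointwise {(w +ᶜ v) *ᶜ z} {w *ᶜ z +ᶜ v *ᶜ z} (λ n → R.distribʳ (at z n) (at w n) (at v n))) }
    ; *-comm = λ z w → ≈ᶜ-pointwise {z *ᶜ w} {w *ᶜ z} (λ n → R.*-comm (at z n) (at w n)) } }
  where module R = CommutativeRing gaussianRationals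

fromℚ² : ℚ × ℚ → ℂ
fromℚ² (p , q) = mkℂ (fromℚ p) (fromℚ q)

fromℚ²-homomorphism : CommutativeRing.rawRing gaussianRationals -Raw-AlmostCommutative⟶ fromCommutativeRing complexNumbers
fromℚ²-homomorphism = record
  { ⟦_⟧    = fromℚ²
  ; +-homo = λ z w → ≈ᶜ-pointwise {fromℚ² (z ⊕ w)} {fromℚ² z +ᶜ fromℚ² w} (λ _ → refl)
  ; *-homo = λ z w → ≈ᶜ-pointwise {fromℚ² (z · w)} {fromℚ² z *ᶜ fromℚ² w} (λ _ → refl)
  ; -‿homo = λ z → ≈ᶜ-pointwise {fromℚ² (negᵍ z)} { -ᶜ fromℚ² z} (λ _ → refl)
  ; 0-homo = ≈ᶜ-pointwise {fromℚ² 0ᵍ} {fromℚ² 0ᵍ} (λ _ → refl)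
  ; 1-homo = ≈ᶜ-pointwise {fromℚ² 1ᵍ} {fromℚ² 1ᵍ} (λ _ → refl) }

-- Lipschitz bounds for the partial sums

∥scale∥ : ∀ z {r} → 0ℚ ≤ r → ∥ (proj₁ z * r , proj₂ z * r) ∥ ≡ ∥ z ∥ * r
∥scale∥ (a , b) {r} 0≤r = trans (cong₂ _+_ (scale a) (scale b)) (sym (*-distribʳ-+ r ∣ a ∣ ∣ b ∣))
  where
  scale : ∀ p → ∣ p * r ∣ ≡ ∣ p ∣ * r
  scale p = trans (∣p*q∣≡∣p∣*∣q∣ p r) (cong (∣ p ∣ *_) (0≤p⇒∣p∣≡p 0≤r))

module _ {B z w} (z≤B : ∥ z ∥ ≤ B) (w≤B : ∥ w ∥ ≤ B) where
  private
    d : ℚ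
    d = ∥ z ⊖ w ∥

    0≤B : 0ℚ ≤ B
    0≤B = ≤-trans (0≤∥∥ z) z≤B

    -- p k = d/dB (B ^ k / k!)
    p : ℕ → ℚ
    p zero    = 0ℚ
    p (suc k) = absTerm k B

    p-*-B : ∀ k → p k * B ≡ ι k * absTerm k B
    p-*-B zero    = trans (*-zeroˡ B) (sym (*-zeroˡ 1ℚ))
    p-*-B (suc k) = sym (trans
      (solve 3 (λ i t r → i :* (t :* r) := r :* i :* t) refl (ι (suc k)) (absTerm k B * B) (recip k))
      (trans (cong (_* (absTerm k B * B)) (recip-ι k)) (*-identityˡ _)))

  -- Induction on z^(k+1) - w^(k+1) = (z^k - w^k) z + w^k (z - w). By `p-*-B` the two bounds add up
  -- to k + 1 copies of `absTerm k B * d`, which `recip k` reduces to one.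
  expTerm-lipschitz : ∀ k → ∥ expTerm k z ⊖ expTerm k w ∥ ≤ p k * d
  expTerm-lipschitz zero    = ≤-reflexive (sym (*-zeroˡ d))
  expTerm-lipschitz (suc k) = subst₂ _≤_
    (trans (sym (∥scale∥ (x ⊕ y) (0≤recip k))) (cong ∥_∥ (sym split))) collect
    (*-monoʳ-≤-nonNeg (recip k) {{nonNegative (0≤recip k)}} (≤-trans (∥⊕∥ x y) (+-mono-≤
      (≤-trans (∥·∥ t z) (mul-mono (0≤∥∥ t) (expTerm-lipschitz k) (0≤∥∥ z) z≤B))
      (≤-trans (∥·∥ (expTerm k w) (z ⊖ w)) (mul-mono (0≤∥∥ (expTerm k w)) (∥expTerm∥ k w w≤B) (0≤∥∥ (z ⊖ w)) ≤-refl)))))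
    where
    t x y : ℚ × ℚ
    t = expTerm k z ⊖ expTerm k w
    x = t · z
    y = expTerm k w · (z ⊖ w)
    split : expTerm (suc k) z ⊖ expTerm (suc k) w ≡ (proj₁ (x ⊕ y) * recip k , proj₂ (x ⊕ y) * recip k)
    split = let (a , b) = expTerm k z ; (a′ , b′) = expTerm k w ; (c , d) = z ; (c′ , d′) = w in cong₂ _,_
      (solve 9 (λ a b a′ b′ c d c′ d′ r → (a :* c :- b :* d) :* r :- (a′ :* c′ :- b′ :* d′) :* r :=
         ((a :- a′) :* c :- (b :- b′) :* d :+ (a′ :* (c :- c′) :- b′ :* (d :- d′))) :* r) refl a b a′ b′ c d c′ d′ (recip k))
      (solve 9 (λ a b a′ b′ c d c′ d′ r → (a :* d :+ b :* c) :* r :- (a′ :* d′ :+ b′ :* c′) :* r :=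
         ((a :- a′) :* d :+ (b :- b′) :* c :+ (a′ :* (d :- d′) :+ b′ :* (c :- c′))) :* r) refl a b a′ b′ c d c′ d′ (recip k))
    collect : (p k * d * B + absTerm k B * d) * recip k ≡ absTerm k B * d
    collect = trans (solve 5 (λ p d B t r → (p :* d :* B :+ t :* d) :* r := (p :* B :+ t) :* d :* r) refl (p k) d B (absTerm k B) (recip k))
      (trans (cong (λ s → (s + absTerm k B) * d * recip k) (p-*-B k))
      (trans (solve 4 (λ i t d r → (i :* t :+ t) :* d :* r := r :* (con 1ℚ :+ i) :* (t :* d)) refl (ι k) (absTerm k B) d (recip k))
      (trans (cong (λ s → recip k * s * (absTerm k B * d)) (sym (ι-suc k)))
      (trans (cong (_* (absTerm k B * d)) (recip-ι k)) (*-identityˡ _)))))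

  expSum-suc-lipschitz : ∀ n → ∥ expSum (suc n) z ⊖ expSum (suc n) w ∥ ≤ absSum n B * d
  expSum-suc-lipschitz zero    = ≤-reflexive (sym (*-zeroˡ d))
  expSum-suc-lipschitz (suc n) = subst₂ _≤_
    (cong ∥_∥ (cong₂ _,_ (regroup (proj₁ s) (proj₁ s′) (proj₁ u) (proj₁ u′)) (regroup (proj₂ s) (proj₂ s′) (proj₂ u) (proj₂ u′))))
    (sym (*-distribʳ-+ d (absSum n B) (absTerm n B)))
    (≤-trans (∥⊕∥ (s ⊖ s′) (u ⊖ u′)) (+-mono-≤ (expSum-suc-lipschitz n) (expTerm-lipschitz (suc n))))
    where
    s s′ u u′ : ℚ × ℚ
    s  = expSum (suc n) z
    s′ = expSum (suc n) w
    u  = expTerm (suc n) z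
    u′ = expTerm (suc n) w
    regroup : ∀ a b c e → a - b + (c - e) ≡ a + c - (b + e)
    regroup = solve 4 (λ a b c e → a :- b :+ (c :- e) := a :+ c :- (b :+ e)) refl

-- The series of derivatives is again the exponential series, whose partial sums at `B` are bounded;
-- this makes `L` independent of n.
expSum-lipschitz : ∀ B → ∃[ L ] 0ℚ ≤ L × (∀ {z w} → ∥ z ∥ ≤ B → ∥ w ∥ ≤ B → ∀ n → ∥ expSum n z ⊖ expSum n w ∥ ≤ L * ∥ z ⊖ w ∥)
expSum-lipschitz B =
  let L , 0≤L , absSum≤L = bounded (absSum-cauchy B)
  in L , 0≤L , λ
    { {z} {w} z≤B w≤B zero    → mul0 0≤L (0≤∥∥ (z ⊖ w))
    ; {z} {w} z≤B w≤B (suc n) → ≤-trans (expSum-suc-lipschitz {B} {z} {w} z≤B w≤B n)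
        (*-monoʳ-≤-nonNeg ∥ z ⊖ w ∥ {{nonNegative (0≤∥∥ (z ⊖ w))}} (≤-trans (p≤∣p∣ (absSum n B)) (absSum≤L n))) }

-- Congruence and functional equation of `exp`

abstract
  exp-cong : ∀ z w → z ≈ᶜ w → exp z ≈ᶜ exp w
  exp-cong z w (p , q) =
    let A , 0≤A , z≤A = ∥at∥-bounded z
        B , 0≤B , w≤B = ∥at∥-bounded w
        L , 0≤L , lip = expSum-lipschitz (A + B)
    in ≈ᶜ-intro {exp z} {exp w} (null-≤ {λ n → ∥ at (exp z) n ⊖ at (exp w) n ∥} {λ n → L * ∥ at z n ⊖ at w n ∥}
         (λ n → lip {at z n} {at w n} (≤-trans (z≤A n) (le B 0≤B refl)) (≤-trans (w≤B n) (le A 0≤A (+-comm A B))) n)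
         (null-* L 0≤L (null-+ p q)))

  exp-+ : ∀ z w → exp (z +ᶜ w) ≈ᶜ exp z *ᶜ exp w
  exp-+ z w =
    let A , 0≤A , z≤A = ∥at∥-bounded z
        B , 0≤B , w≤B = ∥at∥-bounded w
    in CommutativeRing.sym complexNumbers {exp z *ᶜ exp w} {exp (z +ᶜ w)} (≈ᶜ-intro {exp z *ᶜ exp w} {exp (z +ᶜ w)}
      (null-suc {λ n → ∥ at (exp z *ᶜ exp w) n ⊖ at (exp (z +ᶜ w)) n ∥} (null-≤ (λ n → expSum-+ (at z (suc n)) (at w (suc n)) (z≤A (suc n)) (w≤B (suc n)) n)
        (λ ε 0<ε → let N , near = absSum-cauchy (A + B) ε 0<ε in N , λ n N≤n →
          ≤-trans (p≤∣p∣ (absSum (suc (n ℕ.+ n)) (A + B) - absSum (suc n) (A + B))) (near (suc (n ℕ.+ n)) (suc n)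
            (ℕP.m≤n⇒m≤1+n (ℕP.≤-trans N≤n (ℕP.m≤m+n n n))) (ℕP.m≤n⇒m≤1+n N≤n))))))

-- Values at the points found by the grid search

module _ (f : ℕ → ℚ → ℚ) (a : ℚ) (f-left : ∀ n → f n a ≤ 0ℚ) (f-right : ∀ n → 0ℚ ≤ f n (a + 1ℚ)) where
  private
    r : ℕ → ℚ
    r = rootSeq f a

    g : ℕ → ℕ → ℚ
    g n k = f n (grid a n k)

    last : ℕ → ℕ
    last n = lastNonPos (g n) (suc n)

    last-cases : ∀ n → last n ℕ.< suc n ⊎ last n ≡ suc n
    last-cases n = ℕP.m≤n⇒m<n∨m≡n (last-≤ (g n) (suc n))

  root-nonPos : ∀ n → f n (r n) ≤ 0ℚ
  root-nonPos n = cases (last-nonPos (g n) (suc n))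
    where
    cases : last n ≡ 0 ⊎ g n (last n) ≤ 0ℚ → f n (r n) ≤ 0ℚ
    -- Index 0 is the default of `lastNonPos` and never tested by it; it is the left end point,
    -- where `f-left` gives the sign.
    cases (inj₁ k≡0) = subst (λ q → f n q ≤ 0ℚ) (sym (trans (cong (grid a n) k≡0) (grid-0 a n))) (f-left n)
    cases (inj₂ f≤0) = f≤0

  -- The value at the next grid point is positive, so 0 lies between the two values. At the right
  -- end point there is no next grid point, but there `f-right` forces the value to be 0.
  ∣f-root∣≤ : ∀ n → ∣ f n (r n) ∣ ≤ ∣ f n (r n + recip n) - f n (r n) ∣
  ∣f-root∣≤ n = cases (last-cases n)
    where
    y y′ : ℚ
    y  = f n (r n)
    y′ = f n (r n + recip n)
    cases : last n ℕ.< suc n ⊎ last n ≡ suc n → ∣ y ∣ ≤ ∣ y′ - y ∣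
    cases (inj₁ k<) = ∣∣≤ (≤-trans (root-nonPos n) (0≤∣p∣ (y′ - y)))
      (≤-trans (le y′ 0≤y′ (+-comm y′ (- y))) (p≤∣p∣ (y′ - y)))
      where
      0≤y′ : 0ℚ ≤ y′
      0≤y′ = subst (λ q → 0ℚ ≤ f n q) (grid-suc a n (last n)) (<⇒≤ (last-max (g n) (suc n) (suc (last n)) ℕP.≤-refl k<))
    cases (inj₂ k≡) = subst (_≤ ∣ y′ - y ∣) (sym (cong ∣_∣ y≡0)) (0≤∣p∣ (y′ - y))
      where
      y≡0 : y ≡ 0ℚ
      y≡0 = ≤-antisym (root-nonPos n) (subst (λ q → 0ℚ ≤ f n q) (sym (trans (cong (grid a n) k≡) (grid-top a n))) (f-right n))

  -- The sequence enters as `x` with a pointwise equation, so that the constants can be used without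
  -- unfolding their search.
  root-null : ∀ {x : ℕ → ℚ} L → 0ℚ ≤ L → (∀ n → x n ≡ r n) →
              (∀ n → ∣ f n (x n + recip n) - f n (x n) ∣ ≤ L * recip n) → Null (λ n → ∣ f n (x n) ∣)
  root-null {x} L 0≤L x≡r lip = null-≤ {λ n → ∣ f n (x n) ∣} {λ n → L * recip n}
    (λ n → ≤-trans (subst (λ q → ∣ f n q ∣ ≤ ∣ f n (q + recip n) - f n q ∣) (sym (x≡r n)) (∣f-root∣≤ n)) (lip n))
    (null-* L 0≤L recip-null)

-- √5 and φ

recip≤1 : ∀ n → recip n ≤ 1ℚ
recip≤1 n = recip-anti {0} {n} ℕ.z≤n

-- A bound for 2r + h, the difference quotient of the square, when r ≤ 3 and h ≤ 1.
7ℚ : ℚ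
7ℚ = + 7 / 1

square-step : ∀ {r h} → 0ℚ ≤ r → r ≤ + 3 / 1 → 0ℚ ≤ h → h ≤ 1ℚ → ∣ (r + h) * (r + h) - 5ℚ - (r * r - 5ℚ) ∣ ≤ 7ℚ * h
square-step {r} {h} 0≤r r≤3 0≤h h≤1 = subst (_≤ 7ℚ * h)
  (sym (trans (cong ∣_∣ factor) (0≤p⇒∣p∣≡p (mul0 (add0 (add0 0≤r 0≤r) 0≤h) 0≤h))))
  (*-monoʳ-≤-nonNeg h {{nonNegative 0≤h}} (≤-trans (+-mono-≤ (+-mono-≤ r≤3 r≤3) h≤1) (≤ᵇ⇒≤ {+ 3 / 1 + + 3 / 1 + 1ℚ} {7ℚ} _)))
  where
  factor : (r + h) * (r + h) - 5ℚ - (r * r - 5ℚ) ≡ (r + r + h) * h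
  factor = solve 2 (λ r h → (r :+ h) :* (r :+ h) :- con 5ℚ :- (r :* r :- con 5ℚ) := (r :+ r :+ h) :* h) refl r h

abstract
  √5≡root : ∀ n → seq √5 n ≡ rootSeq square-5 2ℚ n
  √5≡root n = refl

  logφ≡root : ∀ n → seq logφ n ≡ rootSeq exp-minus-φ 0ℚ n
  logφ≡root n = refl

  φ≡ : ∀ n → seq φ n ≡ (1ℚ + seq √5 n) * ½
  φ≡ n = refl

√5≤3 : ∀ n → seq √5 n ≤ + 3 / 1
√5≤3 n = subst (_≤ + 3 / 1) (sym (√5≡root n)) (≤-trans (root≤ square-5 2ℚ n) (≤ᵇ⇒≤ {2ℚ + 1ℚ} {+ 3 / 1} _))

2≤√5 : ∀ n → 2ℚ ≤ seq √5 n
2≤√5 n = subst (2ℚ ≤_) (sym (√5≡root n)) (a≤root square-5 2ℚ n)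

√5-null : Null (λ n → ∣ square-5 n (seq √5 n) ∣)
√5-null = root-null square-5 2ℚ (λ _ → ≤ᵇ⇒≤ {2ℚ * 2ℚ - 5ℚ} {0ℚ} _) (λ _ → ≤ᵇ⇒≤ {0ℚ} {(2ℚ + 1ℚ) * (2ℚ + 1ℚ) - 5ℚ} _)
  {seq √5} 7ℚ (nonNegative⁻¹ 7ℚ) √5≡root (λ n → square-step {seq √5 n} {recip n} (≤-trans (nonNegative⁻¹ 2ℚ) (2≤√5 n)) (√5≤3 n) (0≤recip n) (recip≤1 n))

¼ : ℚ
¼ = + 1 / 4

-- At each index the defect x² - (x + 1) is exactly a quarter of s² - 5.
golden-ratio : ∀ {s x} → Null (λ n → ∣ square-5 n (seq s n) ∣) → (∀ n → seq x n ≡ (1ℚ + seq s n) * ½) → x *ʳ x ≈ʳ x +ʳ fromℚ 1ℚ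
golden-ratio {s} {x} s²→5 x≡ = null-≤ {λ n → ∣ seq x n * seq x n - (seq x n + 1ℚ) ∣} {λ n → ¼ * ∣ square-5 n (seq s n) ∣}
  (λ n → ≤-reflexive (trans (cong (λ t → ∣ t * t - (t + 1ℚ) ∣) (x≡ n)) (trans (cong ∣_∣ (quarter (seq s n))) (∣p*q∣≡∣p∣*∣q∣ ¼ (seq s n * seq s n - 5ℚ)))))
  (null-* ¼ (nonNegative⁻¹ ¼) s²→5)
  where
  quarter : ∀ s → (1ℚ + s) * ½ * ((1ℚ + s) * ½) - ((1ℚ + s) * ½ + 1ℚ) ≡ ¼ * (s * s - 5ℚ)
  quarter = solve 1 (λ s → (con 1ℚ :+ s) :* con ½ :* ((con 1ℚ :+ s) :* con ½) :- ((con 1ℚ :+ s) :* con ½ :+ con 1ℚ) := con ¼ :* (s :* s :- con 5ℚ)) refl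

φ-square : φ *ʳ φ ≈ʳ φ +ʳ fromℚ 1ℚ
φ-square = golden-ratio {√5} {φ} √5-null φ≡

-- The exponential of log φ

absSum-null : ∀ B (g : ℕ → ℕ) → (∀ n → n ℕ.≤ g n) → Null (λ n → absSum (g n) B - absSum n B)
absSum-null B g n≤g ε 0<ε = let N , near = absSum-cauchy B ε 0<ε in N , λ n N≤n →
  ≤-trans (p≤∣p∣ (absSum (g n) B - absSum n B)) (near (g n) n (ℕP.≤-trans N≤n (n≤g n)) N≤n)

-- Bridges the n terms that `exp` takes at index n and the `g n` terms in the function whose root
-- was sought.
expSum-reindex : ∀ {B} (z : ℕ → ℚ × ℚ) (g : ℕ → ℕ) → (∀ n → ∥ z n ∥ ≤ B) → (∀ n → n ℕ.≤ g n) →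
                 Null (λ n → ∥ expSum (g n) (z n) ⊖ expSum n (z n) ∥)
expSum-reindex {B} z g z≤B n≤g = null-≤
  (λ n → subst₂ (λ s t → ∥ s ⊖ t ∥ ≤ absSum (g n) B - absSum n B) (sym (expSum≡sum (g n) (z n))) (sym (expSum≡sum n (z n)))
    (sum-diff (λ k → ∥expTerm∥ k (z n) (z≤B n)) (n≤g n)))
  (absSum-null B g n≤g)

absSum-zero : ∀ n → absSum (suc n) 0ℚ ≡ 1ℚ
absSum-zero zero    = refl
absSum-zero (suc n) = trans (cong₂ _+_ (absSum-zero n) (trans (cong (_* recip n) (*-zeroʳ (absTerm n 0ℚ))) (*-zeroˡ (recip n)))) refl

exp-0 : exp (fromℚ² 0ᵍ) ≈ᶜ 1ᶜ
exp-0 = ≈ᶜ-intro {exp (fromℚ² 0ᵍ)} {1ᶜ} (null-suc (null-≤ (λ n → ≤-reflexive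
  (trans (cong (λ t → ∥ t ⊖ 1ᵍ ∥) (trans (expSum-real (suc n) 0ℚ) (cong (_, 0ℚ) (absSum-zero n)))) refl)) 0-null))

expRe : ℕ → ℚ → ℚ
expRe n q = proj₁ (expSum n (q , 0ℚ))

expRe≡absSum : ∀ n q → expRe n q ≡ absSum n q
expRe≡absSum n q = cong proj₁ (expSum-real n q)

1≤φ : ∀ n → 1ℚ ≤ seq φ n
1≤φ n = subst (1ℚ ≤_) (sym (φ≡ n))
  (≤-trans (≤ᵇ⇒≤ {1ℚ} {(1ℚ + 2ℚ) * ½} _) (*-monoʳ-≤-nonNeg ½ (+-monoʳ-≤ 1ℚ (2≤√5 n))))

φ≤2 : ∀ n → seq φ n ≤ 2ℚ
φ≤2 n = subst (_≤ 2ℚ) (sym (φ≡ n))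
  (≤-trans (*-monoʳ-≤-nonNeg ½ (+-monoʳ-≤ 1ℚ (√5≤3 n))) (≤ᵇ⇒≤ {(1ℚ + + 3 / 1) * ½} {2ℚ} _))

0≤logφ : ∀ n → 0ℚ ≤ seq logφ n
0≤logφ n = subst (0ℚ ≤_) (sym (logφ≡root n)) (a≤root exp-minus-φ 0ℚ n)

logφ≤1 : ∀ n → seq logφ n ≤ 1ℚ
logφ≤1 n = subst (_≤ 1ℚ) (sym (logφ≡root n)) (≤-trans (root≤ exp-minus-φ 0ℚ n) (≤ᵇ⇒≤ {0ℚ + 1ℚ} {1ℚ} _))

exp-minus-φ≡ : ∀ n q → exp-minus-φ n q ≡ expRe (2 ℕ.+ n) q - seq φ n
exp-minus-φ≡ n q = refl

exp-minus-φ-left : ∀ n → exp-minus-φ n 0ℚ ≤ 0ℚ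
exp-minus-φ-left n = subst (_≤ 0ℚ) (sym (trans (exp-minus-φ≡ n 0ℚ) (cong (_- seq φ n) (trans (expRe≡absSum (2 ℕ.+ n) 0ℚ) (absSum-zero (suc n))))))
  (subst (1ℚ - seq φ n ≤_) (+-inverseʳ (seq φ n)) (+-monoˡ-≤ (- seq φ n) (1≤φ n)))

exp-minus-φ-right : ∀ n → 0ℚ ≤ exp-minus-φ n 1ℚ
exp-minus-φ-right n = subst (0ℚ ≤_) (sym (trans (exp-minus-φ≡ n 1ℚ) (cong (_- seq φ n) (expRe≡absSum (2 ℕ.+ n) 1ℚ))))
  -- The first two terms at 1 already add up to 2, which bounds φ from above.
  (gap (≤-trans (φ≤2 n) (sum-mono {λ k → absTerm k 1ℚ} (λ i → 0≤absTerm i 0≤1) {2} {2 ℕ.+ n} (ℕ.s≤s (ℕ.s≤s ℕ.z≤n)))))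

∥real∥ : ∀ {q} → 0ℚ ≤ q → ∥ (q , 0ℚ) ∥ ≡ q
∥real∥ {q} 0≤q = trans (+-identityʳ ∣ q ∣) (0≤p⇒∣p∣≡p 0≤q)

expRe-step : ∀ {q h} L → 0ℚ ≤ q → q ≤ 1ℚ → 0ℚ ≤ h → h ≤ 1ℚ →
             (∀ {z w} → ∥ z ∥ ≤ 2ℚ → ∥ w ∥ ≤ 2ℚ → ∀ n → ∥ expSum n z ⊖ expSum n w ∥ ≤ L * ∥ z ⊖ w ∥) →
             ∀ n → ∣ expRe n (q + h) - expRe n q ∣ ≤ L * h
expRe-step {q} {h} L 0≤q q≤1 0≤h h≤1 lip n = subst (∣ expRe n (q + h) - expRe n q ∣ ≤_) (cong (L *_) dist)
  (≤-trans (re≤∥∥ (expSum n (q + h , 0ℚ) ⊖ expSum n (q , 0ℚ)))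
    (lip {q + h , 0ℚ} {q , 0ℚ}
      (subst (_≤ 2ℚ) (sym (∥real∥ (add0 0≤q 0≤h))) (≤-trans (+-mono-≤ q≤1 h≤1) (≤ᵇ⇒≤ {1ℚ + 1ℚ} {2ℚ} _)))
      (subst (_≤ 2ℚ) (sym (∥real∥ 0≤q)) (≤-trans q≤1 (≤ᵇ⇒≤ {1ℚ} {2ℚ} _))) n))
  where
  dist : ∥ (q + h , 0ℚ) ⊖ (q , 0ℚ) ∥ ≡ h
  dist = trans (+-identityʳ ∣ q + h - q ∣) (trans (cong ∣_∣ (solve 2 (λ q h → q :+ h :- q := h) refl q h)) (0≤p⇒∣p∣≡p 0≤h))

logφ-null : Null (λ n → ∣ exp-minus-φ n (seq logφ n) ∣)
logφ-null =
  let L , 0≤L , lip = expSum-lipschitz 2ℚ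
  in root-null exp-minus-φ 0ℚ exp-minus-φ-left exp-minus-φ-right {seq logφ} L 0≤L logφ≡root
       (λ n → subst (_≤ L * recip n) (sym (cong ∣_∣ (difference (seq logφ n) (recip n) n)))
         (expRe-step {seq logφ n} {recip n} L (0≤logφ n) (logφ≤1 n) (0≤recip n) (recip≤1 n) lip (2 ℕ.+ n)))
  where
  difference : ∀ q h n → exp-minus-φ n (q + h) - exp-minus-φ n q ≡ expRe (2 ℕ.+ n) (q + h) - expRe (2 ℕ.+ n) q
  difference q h n = trans (cong₂ _-_ (exp-minus-φ≡ n (q + h)) (exp-minus-φ≡ n q))
    (solve 3 (λ a b c → a :- c :- (b :- c) := a :- b) refl (expRe (2 ℕ.+ n) (q + h)) (expRe (2 ℕ.+ n) q) (seq φ n))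

-- The partial sum of 2 + n terms is the intermediate point of a triangle inequality; the imaginary
-- part is 0 at every index.
exp-real : ∀ {x y} → (∀ n → 0ℚ ≤ seq x n) → (∀ n → seq x n ≤ 1ℚ) →
           Null (λ n → ∣ expRe (2 ℕ.+ n) (seq x n) - seq y n ∣) → exp (fromℝ x) ≈ᶜ fromℝ y
exp-real {x} {y} 0≤x x≤1 x→y =
  null-≤ {λ n → ∣ expRe n (seq x n) - seq y n ∣}
    {λ n → ∥ expSum (2 ℕ.+ n) (seq x n , 0ℚ) ⊖ expSum n (seq x n , 0ℚ) ∥ + ∣ expRe (2 ℕ.+ n) (seq x n) - seq y n ∣}
    (λ n → ≤-trans (tri (expRe n (seq x n)) (expRe (2 ℕ.+ n) (seq x n)) (seq y n))
      (+-monoˡ-≤ ∣ expRe (2 ℕ.+ n) (seq x n) - seq y n ∣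
        (≤-trans (≤-reflexive (∣-∣-sym (expRe n (seq x n)) (expRe (2 ℕ.+ n) (seq x n))))
          (re≤∥∥ (expSum (2 ℕ.+ n) (seq x n , 0ℚ) ⊖ expSum n (seq x n , 0ℚ))))))
    (null-+ (expSum-reindex {1ℚ} (λ n → seq x n , 0ℚ) (2 ℕ.+_) (λ n → subst (_≤ 1ℚ) (sym (∥real∥ (0≤x n))) (x≤1 n)) (λ n → ℕP.m≤n+m n 2)) x→y) ,
  ≈ʳ-pointwise {im (exp (fromℝ x))} {fromℚ 0ℚ} (λ n → cong proj₂ (expSum-real n (seq x n)))

exp-logφ : exp (fromℝ logφ) ≈ᶜ fromℝ φ
exp-logφ = exp-real {logφ} {φ} 0≤logφ logφ≤1
  (null-≤ {λ n → ∣ expRe (2 ℕ.+ n) (seq logφ n) - seq φ n ∣} {λ n → ∣ exp-minus-φ n (seq logφ n) ∣}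
    (λ n → ≤-reflexive (sym (cong ∣_∣ (exp-minus-φ≡ n (seq logφ n))))) logφ-null)

-- The cosine at π / 2 and complex conjugation

halfπ : ℝ
halfπ = mkℝ (rootSeq neg-cos 1ℚ) (root-cauchy neg-cos 1ℚ neg-cos-increasing)

abstract
  halfπ≡root : ∀ n → seq halfπ n ≡ rootSeq neg-cos 1ℚ n
  halfπ≡root n = refl

  π≡2*halfπ : ∀ n → seq π n ≡ 2ℚ * seq halfπ n
  π≡2*halfπ n = refl

0≤halfπ : ∀ n → 0ℚ ≤ seq halfπ n
0≤halfπ n = ≤-trans 0≤1 (subst (1ℚ ≤_) (sym (halfπ≡root n)) (a≤root neg-cos 1ℚ n))

halfπ≤2 : ∀ n → seq halfπ n ≤ 2ℚ
halfπ≤2 n = subst (_≤ 2ℚ) (sym (halfπ≡root n)) (≤-trans (root≤ neg-cos 1ℚ n) (≤ᵇ⇒≤ {1ℚ + 1ℚ} {2ℚ} _))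

σ≤1 : ∀ k → σ k ≤ 1ℚ
σ≤1 k = mul-mono (0≤recip k) (recip≤1 k) (0≤recip (suc k)) (recip≤1 (suc k))

0≤β : ∀ n {u} → 0ℚ ≤ u → 0ℚ ≤ β n u
0≤β n 0≤u = proj₁ (β-mono n 0≤u ≤-refl)

β-halves : ∀ n → β (suc n) 1ℚ + β (suc n) 1ℚ ≤ β n 1ℚ
β-halves n = subst₂ _≤_
  (solve 2 (λ b s → b :* (s :+ s) := b :* (con 1ℚ :* con 1ℚ) :* s :+ b :* (con 1ℚ :* con 1ℚ) :* s) refl (β n 1ℚ) s)
  (*-identityʳ (β n 1ℚ))
  (*-monoˡ-≤-nonNeg (β n 1ℚ) {{nonNegative (0≤β n 0≤1)}}
    (≤-trans (+-mono-≤ s≤ s≤) (≤ᵇ⇒≤ {+ 1 / 12 * 1ℚ + + 1 / 12 * 1ℚ} {1ℚ} _)))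
  where
  k : ℕ
  k = n ℕ.* 4 ℕ.+ 2
  s : ℚ
  s = σ k * σ (2 ℕ.+ k)
  s≤ : s ≤ + 1 / 12 * 1ℚ
  s≤ = mul-mono (0≤σ k) (σ≤ n) (0≤σ (2 ℕ.+ k)) (σ≤1 (2 ℕ.+ k))

drop-1≤β : ∀ n → drop n 1ℚ ≤ β n 1ℚ
drop-1≤β n = le (β n 1ℚ * σ (n ℕ.* 4 ℕ.+ 2)) (mul0 (0≤β n 0≤1) (0≤σ (n ℕ.* 4 ℕ.+ 2)))
  (solve 2 (λ b s → b := b :* (con 1ℚ :* (con 1ℚ :- con 1ℚ :* s)) :+ b :* s) refl (β n 1ℚ) (σ (n ℕ.* 4 ℕ.+ 2)))

cosSum-drop : ∀ n {q u} → q * q ≡ u → cosSum (suc n) q ≡ cosSum n q - drop n u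
cosSum-drop n {q} refl = cosSum-suc n q

half-≤-minus : ∀ {b c d} → b + b ≤ c → d ≤ b → b ≤ c - d
half-≤-minus {b} {c} {d} 2b≤c d≤b = le (c - (b + b) + (b - d)) (add0 (gap 2b≤c) (gap d≤b))
  (solve 3 (λ b c d → c :- d := b :+ (c :- (b :+ b) :+ (b :- d))) refl b c d)

minus-nonneg-≤ : ∀ {c d} → 0ℚ ≤ d → c - d ≤ c
minus-nonneg-≤ {c} {d} 0≤d = le d 0≤d (solve 2 (λ c d → c := c :- d :+ d) refl c d)

-- Positivity alone is not inductive, since these sums decrease with n. The reserve 2 / (4n + 2)!,
-- twice `β n 1ℚ`, is: the next drop consumes at most half of it, and `β-halves` covers the next
-- reserve by the other half. At n = 0 equality holds.
cosSum-1 : ∀ n → β n 1ℚ + β n 1ℚ ≤ cosSum n 1ℚ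
cosSum-1 zero    = ≤-reflexive (sym (cosSum-0 1ℚ))
cosSum-1 (suc n) = ≤-trans {β (suc n) 1ℚ + β (suc n) 1ℚ} {β n 1ℚ} {cosSum (suc n) 1ℚ} (β-halves n)
  (subst (β n 1ℚ ≤_) (sym (cosSum-drop n {1ℚ} {1ℚ} (*-identityˡ 1ℚ)))
    (half-≤-minus {β n 1ℚ} {cosSum n 1ℚ} {drop n 1ℚ} (cosSum-1 n) (drop-1≤β n)))

-- `drop n` vanishes at 0 and `drop-mono` reaches exactly up to 4.
0≤drop-4 : ∀ n → 0ℚ ≤ drop n 4ℚ
0≤drop-4 n = subst (_≤ drop n 4ℚ) (trans (cong (β n 0ℚ *_) (*-zeroˡ (1ℚ - 0ℚ * σ (n ℕ.* 4 ℕ.+ 2)))) (*-zeroʳ (β n 0ℚ)))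
  (drop-mono n {0ℚ} {4ℚ} ≤-refl (nonNegative⁻¹ 4ℚ) ≤-refl)

2*2≡4 : 2ℚ * 2ℚ ≡ 4ℚ
2*2≡4 = refl

1-drop-4≤0 : 1ℚ - drop 0 4ℚ ≤ 0ℚ
1-drop-4≤0 = ≤ᵇ⇒≤ {1ℚ - drop 0 4ℚ} {0ℚ} _

cosSum-2-zero : ∀ {q} → q * q ≡ 4ℚ → cosSum 1 q ≤ 0ℚ
cosSum-2-zero {q} q²≡4 = ≤-trans (≤-reflexive (trans (cosSum-drop 0 {q} {4ℚ} q²≡4) (cong (_- drop 0 4ℚ) (cosSum-0 q)))) 1-drop-4≤0

-- Three terms give 1 - 2 + 2/3 = - 1/3, and every later drop only lowers the sum.
cosSum-2 : ∀ {q} → q * q ≡ 4ℚ → ∀ n → cosSum (suc n) q ≤ 0ℚ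
cosSum-2 {q} q²≡4 zero    = cosSum-2-zero {q} q²≡4
cosSum-2 {q} q²≡4 (suc n) = ≤-trans {cosSum (2 ℕ.+ n) q} {cosSum (suc n) q} {0ℚ}
  (subst (_≤ cosSum (suc n) q) (sym (cosSum-drop (suc n) {q} {4ℚ} q²≡4)) (minus-nonneg-≤ {cosSum (suc n) q} {drop (suc n) 4ℚ} (0≤drop-4 (suc n))))
  (cosSum-2 {q} q²≡4 n)

neg-cos-left : ∀ n → neg-cos n 1ℚ ≤ 0ℚ
neg-cos-left n = neg-antimono-≤ (≤-trans (add0 (0≤β (suc n) 0≤1) (0≤β (suc n) 0≤1)) (cosSum-1 (suc n)))

neg-cos-right : ∀ n → 0ℚ ≤ neg-cos n 2ℚ
neg-cos-right n = neg-antimono-≤ (cosSum-2 {2ℚ} 2*2≡4 n)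

∥imaginary∥ : ∀ {q} → 0ℚ ≤ q → ∥ (0ℚ , q) ∥ ≡ q
∥imaginary∥ {q} 0≤q = trans (+-identityˡ ∣ q ∣) (0≤p⇒∣p∣≡p 0≤q)

cosSum-step : ∀ {q h} L → 0ℚ ≤ q → q ≤ 2ℚ → 0ℚ ≤ h → h ≤ 1ℚ →
              (∀ {z w} → ∥ z ∥ ≤ + 3 / 1 → ∥ w ∥ ≤ + 3 / 1 → ∀ n → ∥ expSum n z ⊖ expSum n w ∥ ≤ L * ∥ z ⊖ w ∥) →
              ∀ n → ∣ cosSum n (q + h) - cosSum n q ∣ ≤ L * h
cosSum-step {q} {h} L 0≤q q≤2 0≤h h≤1 lip n = subst (∣ cosSum n (q + h) - cosSum n q ∣ ≤_) (cong (L *_) dist)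
  (≤-trans (re≤∥∥ (expSum k (0ℚ , q + h) ⊖ expSum k (0ℚ , q)))
    (lip {0ℚ , q + h} {0ℚ , q}
      (subst (_≤ + 3 / 1) (sym (∥imaginary∥ (add0 0≤q 0≤h))) (≤-trans (+-mono-≤ q≤2 h≤1) (≤ᵇ⇒≤ {2ℚ + 1ℚ} {+ 3 / 1} _)))
      (subst (_≤ + 3 / 1) (sym (∥imaginary∥ 0≤q)) (≤-trans q≤2 (≤ᵇ⇒≤ {2ℚ} {+ 3 / 1} _))) k))
  where
  k : ℕ
  k = n ℕ.* 4 ℕ.+ 2
  dist : ∥ (0ℚ , q + h) ⊖ (0ℚ , q) ∥ ≡ h
  dist = trans (+-identityˡ ∣ q + h - q ∣) (trans (cong ∣_∣ (solve 2 (λ q h → q :+ h :- q := h) refl q h)) (0≤p⇒∣p∣≡p 0≤h))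

neg-cos-null : Null (λ n → ∣ neg-cos n (seq halfπ n) ∣)
neg-cos-null =
  let L , 0≤L , lip = expSum-lipschitz (+ 3 / 1)
  in root-null neg-cos 1ℚ neg-cos-left neg-cos-right {seq halfπ} L 0≤L halfπ≡root
       (λ n → subst (_≤ L * recip n) (sym (difference (seq halfπ n) (recip n) n))
         (cosSum-step {seq halfπ n} {recip n} L (0≤halfπ n) (halfπ≤2 n) (0≤recip n) (recip≤1 n) lip (suc n)))
  where
  difference : ∀ q h n → ∣ neg-cos n (q + h) - neg-cos n q ∣ ≡ ∣ cosSum (suc n) (q + h) - cosSum (suc n) q ∣
  difference q h n = trans (cong ∣_∣ (solve 2 (λ a b → :- a :- (:- b) := b :- a) refl (cosSum (suc n) (q + h)) (cosSum (suc n) q)))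
    (∣-∣-sym (cosSum (suc n) q) (cosSum (suc n) (q + h)))

𝕚* : ℝ → ℂ
𝕚* x = mkℂ (fromℚ 0ℚ) x

exp-imaginary-re : ∀ {x B} → (∀ n → 0ℚ ≤ seq x n) → (∀ n → seq x n ≤ B) → Null (λ n → ∣ neg-cos n (seq x n) ∣) →
                   re (exp (𝕚* x)) ≈ʳ fromℚ 0ℚ
exp-imaginary-re {x} {B} 0≤x x≤B x→0 =
  null-≤ {λ n → ∣ proj₁ (expSum n (z n)) - 0ℚ ∣} {λ n → ∥ expSum (g n) (z n) ⊖ expSum n (z n) ∥ + ∣ neg-cos n (seq x n) ∣}
    (λ n → ≤-trans (tri (proj₁ (expSum n (z n))) (cosSum (suc n) (seq x n)) 0ℚ)
      (+-mono-≤
        (≤-trans (≤-reflexive (∣-∣-sym (proj₁ (expSum n (z n))) (cosSum (suc n) (seq x n)))) (re≤∥∥ (expSum (g n) (z n) ⊖ expSum n (z n))))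
        (≤-reflexive (trans (cong ∣_∣ (+-identityʳ (cosSum (suc n) (seq x n)))) (sym (∣-p∣≡∣p∣ (cosSum (suc n) (seq x n))))))))
    (null-+ (expSum-reindex {B} z g (λ n → subst (_≤ B) (sym (∥imaginary∥ (0≤x n))) (x≤B n)) n≤g) x→0)
  where
  g : ℕ → ℕ
  -- The number of terms in `cosSum (suc n)`, hence in `neg-cos n`.
  g n = suc n ℕ.* 4 ℕ.+ 2
  z : ℕ → ℚ × ℚ
  z n = 0ℚ , seq x n
  n≤g : ∀ n → n ℕ.≤ g n
  n≤g n = ℕP.≤-trans (ℕP.n≤1+n n) (ℕP.≤-trans (ℕP.m≤m*n (suc n) 4) (ℕP.m≤m+n (suc n ℕ.* 4) 2))

conj : ℚ × ℚ → ℚ × ℚ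
conj (p , q) = p , - q

expTerm-conj : ∀ k z → expTerm k (conj z) ≡ conj (expTerm k z)
expTerm-conj zero    z = refl
expTerm-conj (suc k) z = trans (cong (λ t → proj₁ (t · conj z) * recip k , proj₂ (t · conj z) * recip k) (expTerm-conj k z))
  (let (a , b) = expTerm k z ; (c , d) = z in cong₂ _,_
    (solve 5 (λ a b c d r → (a :* c :- (:- b) :* (:- d)) :* r := (a :* c :- b :* d) :* r) refl a b c d (recip k))
    (solve 5 (λ a b c d r → (a :* (:- d) :+ (:- b) :* c) :* r := :- ((a :* d :+ b :* c) :* r)) refl a b c d (recip k)))

expSum-conj : ∀ n z → expSum n (conj z) ≡ conj (expSum n z)
expSum-conj zero    z = refl
expSum-conj (suc n) z = trans (cong₂ _⊕_ (expSum-conj n z) (expTerm-conj n z))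
  (cong (proj₁ (expSum n z) + proj₁ (expTerm n z) ,_) (sym (neg-distrib-+ (proj₂ (expSum n z)) (proj₂ (expTerm n z)))))

-- Negating a purely imaginary number conjugates it, and the coefficients of the series are real.
exp-conj : ∀ x → exp (-ᶜ 𝕚* x) ≈ᶜ mkℂ (re (exp (𝕚* x))) (-ʳ im (exp (𝕚* x)))
exp-conj x = ≈ᶜ-pointwise {exp (-ᶜ 𝕚* x)} {mkℂ (re (exp (𝕚* x))) (-ʳ im (exp (𝕚* x)))} (λ n → expSum-conj n (0ℚ , seq x n))

-- The value of `exp` at i π and the recurrence over ℂ

open RingWithExponential complexNumbers fromℚ²-homomorphism
open ExponentialLaws exp exp-cong exp-+ exp-0

exp-2halfπ : exp (𝕚* halfπ +ᶜ 𝕚* halfπ) ≈ᶜ -ᶜ 1ᶜ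
exp-2halfπ = exp-double {𝕚* halfπ} {𝕚* (im (exp (𝕚* halfπ)))} (cos≈0 , ≈ʳ-pointwise {y} {y} (λ _ → refl))
  (CommutativeRing.trans complexNumbers {exp (-ᶜ 𝕚* halfπ)} {mkℂ (re (exp (𝕚* halfπ))) (-ʳ y)} { -ᶜ 𝕚* y}
    (exp-conj halfπ) (cos≈0 , ≈ʳ-pointwise { -ʳ y} { -ʳ y} (λ _ → refl)))
  where
  y : ℝ
  y = im (exp (𝕚* halfπ))
  cos≈0 : re (exp (𝕚* halfπ)) ≈ʳ fromℚ 0ℚ
  cos≈0 = exp-imaginary-re {halfπ} {2ℚ} 0≤halfπ halfπ≤2 neg-cos-null

exp-𝕚π : exp (𝕚 *ᶜ fromℝ π) ≈ᶜ -ᶜ 1ᶜ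
exp-𝕚π = CommutativeRing.trans complexNumbers {exp (𝕚 *ᶜ fromℝ π)} {exp (𝕚* halfπ +ᶜ 𝕚* halfπ)} { -ᶜ 1ᶜ}
  (exp-cong (𝕚 *ᶜ fromℝ π) (𝕚* halfπ +ᶜ 𝕚* halfπ) (≈ᶜ-pointwise {𝕚 *ᶜ fromℝ π} {𝕚* halfπ +ᶜ 𝕚* halfπ} twice)) exp-2halfπ
  where
  double : ∀ {p h} → p ≡ 2ℚ * h → (0ℚ , 1ℚ) · (p , 0ℚ) ≡ (0ℚ , h) ⊕ (0ℚ , h)
  double {h = h} refl = cong₂ _,_
    (solve 1 (λ h → con 0ℚ :* (con 2ℚ :* h) :- con 1ℚ :* con 0ℚ := con 0ℚ :+ con 0ℚ) refl h)
    (solve 1 (λ h → con 0ℚ :* con 0ℚ :+ con 1ℚ :* (con 2ℚ :* h) := h :+ h) refl h)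
  twice : ∀ n → at (𝕚 *ᶜ fromℝ π) n ≡ at (𝕚* halfπ +ᶜ 𝕚* halfπ) n
  twice n = double {seq π n} {seq halfπ n} (π≡2*halfπ n)

fromℝφ-square : fromℝ φ *ᶜ fromℝ φ ≈ᶜ fromℝ φ +ᶜ 1ᶜ
fromℝφ-square = lift {φ} φ-square
  where
  lift : ∀ {x} → x *ʳ x ≈ʳ x +ʳ fromℚ 1ℚ → fromℝ x *ᶜ fromℝ x ≈ᶜ fromℝ x +ᶜ 1ᶜ
  lift {x} p = CommutativeRing.trans complexNumbers {fromℝ x *ᶜ fromℝ x} {fromℝ (x *ʳ x)} {fromℝ x +ᶜ 1ᶜ}
    (≈ᶜ-pointwise {fromℝ x *ᶜ fromℝ x} {fromℝ (x *ʳ x)} (λ n → real-· (seq x n) (seq x n)))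
    (p , ≈ʳ-pointwise {fromℚ 0ℚ} {fromℚ 0ℚ +ʳ fromℚ 0ℚ} (λ _ → refl))

-- The functions are variables because Agda would evaluate π and φ when comparing two forms of their values.
isComplete : ∀ (a l x s : ℂ) → exp a ≈ᶜ -ᶜ 1ᶜ → exp l ≈ᶜ x → x *ᶜ x ≈ᶜ x +ᶜ 1ᶜ →
             (e X Y Θ : ℂ → ℂ) → (∀ n → e n ≡ exp (a *ᶜ n)) → (∀ n → X n ≡ exp (n *ᶜ l)) →
             (∀ n → Y n ≡ e (-ᶜ n) *ᶜ X (-ᶜ n)) → (∀ n → Θ n ≡ (X n -ᶜ Y n) *ᶜ s) →
             (η γ : ℂ) (Ω : ℂ → ℂ) → (∀ n → Ω n ≡ η *ᶜ e (n -ᶜ 1ᶜ) *ᶜ Θ n +ᶜ γ *ᶜ e n *ᶜ Θ (n -ᶜ 1ᶜ) *ᶜ x) →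
             IsCompleteNFeSequence Ω
isComplete a l x s exp-a exp-l x-square e X Y Θ e≡ X≡ Y≡ Θ≡ η γ Ω Ω≡ = record
  { respects-≈ = λ {n} {m} → Ω-cong {n} {m}
  ; recurrence = Ω-recurrence
  }
  where
  open Fibonacci a l x s exp-a exp-l x-square e X Y Θ e≡ X≡ Y≡ Θ≡
  open Combination η γ Ω Ω≡

theorem3p4 : ∀ (η γ : ℂ) → IsCompleteNFeSequence (Ω η γ)
theorem3p4 η γ = isComplete (𝕚 *ᶜ fromℝ π) (fromℝ logφ) (fromℝ φ) (fromℝ (invʳ √5 √5#0)) exp-𝕚π exp-logφ fromℝφ-square
  [-1]^_ φ^_ (λ n → [-φ]^ (-ᶜ n)) Θ (λ _ → refl) (λ _ → refl) (λ _ → refl) (λ _ → refl) η γ (Ω η γ) (λ _ → refl)
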